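{- Let $\lambda$ and $\mathbf{a}=(a_\ell)_{\ell\ge0}$, $\mathbf{b}=(b_{\ell,\ell'})$, $\mathbf{c}=(c_{\ell,\ell'})$, $\mathbf{d}=(d_{\ell,\ell'})$ ($\ell,\ell'\ge0$), $\mathbf{e}=(e_\ell)_{\ell\ge0}$, $\mathbf{f}=(f_\ell)_{\ell\ge0}$ be commuting indeterminates, and for $n\ge0$ let \[ \widehat{Q}_n=\sum_{\sigma\in\mathfrak{D}_{2n}}\lambda^{\mathrm{cyc}(\sigma)}\prod_{i\in\mathrm{Cval}(\sigma)}a_{\mathrm{ucross}(i,\sigma)+\mathrm{unest}(i,\sigma)}\prod_{i\in\mathrm{Cpeak}(\sigma)}b_{\mathrm{lcross}(i,\sigma),\mathrm{lnest}(i,\sigma)}\prod_{i\in\mathrm{Cdfall}(\sigma)}c_{\mathrm{lcross}(i,\sigma),\mathrm{lnest}(i,\sigma)}\prod_{i\in\mathrm{Cdrise}(\sigma)}d_{\mathrm{ucross}(i,\sigma),\mathrm{unest}(i,\sigma)}\prod_{i\in\mathrm{Evenfix}(\sigma)}e_{\mathrm{psnest}(i,\sigma)}\prod_{i\in\mathrm{Oddfix}(\sigma)}f_{\mathrm{psnest}(i,\sigma)}. \] Then \[ \sum_{n\ge0}\widehat{Q}_nt^n=\cfrac{1}{1-\delta_1t-\cfrac{\alpha_1t}{1-\delta_2t-\cfrac{\alpha_2t}{1-\cdots}}} \] as formal power series in $t$, where for $k\ge1$: $\alpha_{2k-1}=(\lambda+k-1)\,a_{k-1}\sum_{\xi=0}^{k-1}b_{k-1-\xi,\xi}$,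 $\alpha_{2k}=\big(\lambda e_k+\sum_{\xi=0}^{k-1}c_{k-1-\xi,\xi}\big)\big(\lambda f_k+\sum_{\xi=0}^{k-1}d_{k-1-\xi,\xi}\big)$, $\delta_1=\lambda^2e_0f_0$ and $\delta_n=0$ for $n\ge2$.
   Context: A D-permutation of $[2n]$ is a permutation $\sigma$ with $\sigma(2k-1)\ge2k-1$ and $\sigma(2k)\le 2k$ for all $k$; $\mathfrak{D}_{2n}$ is their set. $\mathrm{Cpeak}(\sigma)=\{i:\sigma^{ -1}(i)<i>\sigma(i)\}$, $\mathrm{Cval}(\sigma)=\{i:\sigma^{ -1}(i)>i<\sigma(i)\}$, $\mathrm{Cdrise}(\sigma)=\{i:\sigma^{ -1}(i)<i<\sigma(i)\}$, $\mathrm{Cdfall}(\sigma)=\{i:\sigma^{ -1}(i)>i>\sigma(i)\}$, $\mathrm{Evenfix}(\sigma)$ ($\mathrm{Oddfix}(\sigma)$) = set of even (odd) $i$ with $\sigma(i)=i$. $\mathrm{cyc}$ = number of cycles (fixed points included). $\mathrm{ucross}(j,\sigma)=\#\{(i,k,l):i<j<k<l,\ k=\sigma(i),\ l=\sigma(j)\}$, $\mathrm{unest}(j,\sigma)=\#\{(i,k,l):i<j<k<l,\ k=\sigma(j),\ l=\sigma(i)\}$, $\mathrm{lcross}(k,\sigma)=\#\{(i,j,l):i<j<k<l,\ i=\sigma(k),\ j=\sigma(l)\}$, $\mathrm{lnest}(k,\sigma)=\#\{(i,j,l):i<j<k<l,\ i=\sigma(l),\ j=\sigma(k)\}$, and for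 a fixed point $i$, $\mathrm{psnest}(i,\sigma)=\#\{j<i:\sigma(j)>i\}$. -}

module Defs where

open import Level using (Level)
open import Algebra.Bundles using (CommutativeRing)
open import Data.Bool using (Bool; true; false; if_then_else_; _∧_; not)
open import Data.Nat as ℕ using (ℕ; zero; suc; _∸_; ⌊_/2⌋)
import Data.Nat.Properties as ℕP
open import Data.Fin as F using (Fin; toℕ)
import Data.Fin.Properties as FP
open import Data.List as L using (List; []; _∷_; upTo; allFin; filterᵇ; concatMap)
open import Data.Vec as V using (Vec; []; _∷_; lookup; tabulate)
open import Relation.Nullary.Decidable using (⌊_⌋)

ltB : ℕ → ℕ → Bool
ltB a b = ⌊ a ℕ.<? b ⌋

leB : ℕ → ℕ → Bool
leB a b = ⌊ a ℕ.≤? b ⌋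

eqB : ℕ → ℕ → Bool
eqB a b = ⌊ a ℕ.≟ b ⌋

evenB : ℕ → Bool
evenB zero = true
evenB (suc n) = not (evenB n)

allB : {A : Set} → (A → Bool) → List A → Bool
allB p [] = true
allB p (x ∷ xs) = p x ∧ allB p xs

countB : {A : Set} → (A → Bool) → List A → ℕ
countB p xs = L.length (filterᵇ p xs)

findB : {A : Set} → (A → Bool) → List A → A → A
findB p [] d = d
findB p (x ∷ xs) d = if p x then x else findB p xs d

allVecs : (k m : ℕ) → List (Vec (Fin m) k)
allVecs zero m = [] ∷ []
allVecs (suc k) m = concatMap (λ i → L.map (i ∷_) (allVecs k m)) (allFin m)

module _ {m : ℕ} (σ : Vec (Fin m) m) where

  -- positions are 1-based: element i : Fin m stands for toℕ i + 1
  pos : Fin m → ℕ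
  pos i = suc (toℕ i)

  s : Fin m → ℕ
  s i = pos (lookup σ i)

  isPerm : Bool
  isPerm = allB (λ i → allB (λ j → not (eqB (s i) (s j)) Data.Bool.∨ eqB (pos i) (pos j))
                                (allFin m)) (allFin m)

  isD : Bool
  isD = allB (λ i → if evenB (pos i) then leB (s i) (pos i) else leB (pos i) (s i)) (allFin m)

  -- σ⁻¹(i) (for a permutation): the unique j with σ(j) = i
  sinv : Fin m → ℕ
  sinv i = pos (findB (λ j → eqB (s j) (pos i)) (allFin m) i)

  isCpeak isCval isCdrise isCdfall isEvenfix isOddfix : Fin m → Bool
  isCpeak i = ltB (sinv i) (pos i) ∧ ltB (s i) (pos i)
  isCval i = ltB (pos i) (sinv i) ∧ ltB (pos i) (s i)
  isCdrise i = ltB (sinv i) (pos i) ∧ ltB (pos i) (s i)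
  isCdfall i = ltB (pos i) (sinv i) ∧ ltB (s i) (pos i)
  isEvenfix i = eqB (s i) (pos i) ∧ evenB (pos i)
  isOddfix i = eqB (s i) (pos i) ∧ not (evenB (pos i))

  -- ucross(j) = #{(i,k,l) : i<j<k<l, k=σ(i), l=σ(j)}
  ucross : Fin m → ℕ
  ucross j = countB (λ i → ltB (pos i) (pos j) ∧ ltB (pos j) (s i) ∧ ltB (s i) (s j)) (allFin m)

  -- unest(j) = #{(i,k,l) : i<j<k<l, k=σ(j), l=σ(i)}
  unest : Fin m → ℕ
  unest j = countB (λ i → ltB (pos i) (pos j) ∧ ltB (pos j) (s j) ∧ ltB (s j) (s i)) (allFin m)

  -- lcross(k) = #{(i,j,l) : i<j<k<l, i=σ(k), j=σ(l)}
  lcross : Fin m → ℕ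
  lcross k = countB (λ l → ltB (s k) (s l) ∧ ltB (s l) (pos k) ∧ ltB (pos k) (pos l)) (allFin m)

  -- lnest(k) = #{(i,j,l) : i<j<k<l, i=σ(l), j=σ(k)}
  lnest : Fin m → ℕ
  lnest k = countB (λ l → ltB (s l) (s k) ∧ ltB (s k) (pos k) ∧ ltB (pos k) (pos l)) (allFin m)

  psnest : Fin m → ℕ
  psnest i = countB (λ j → ltB (pos j) (pos i) ∧ ltB (pos i) (s j)) (allFin m)

  iter : ℕ → Fin m → Fin m
  iter zero i = i
  iter (suc k) i = lookup σ (iter k i)

  -- number of cycles = number of elements that are the minimum of their cycle
  -- (the cycle of i is {σ^k(i) : 1 ≤ k ≤ m})
  cyc : ℕ
  cyc = countB (λ i → allB (λ k → leB (pos i) (pos (iter (suc k) i))) (upTo m)) (allFin m)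

Dperms : (n : ℕ) → List (Vec (Fin (2 ℕ.* n)) (2 ℕ.* n))
Dperms n = filterᵇ (λ σ → isPerm σ ∧ isD σ) (allVecs (2 ℕ.* n) (2 ℕ.* n))

module _ {c ℓ : Level} (R : CommutativeRing c ℓ) where
  open CommutativeRing R

  sumR : List Carrier → Carrier
  sumR = L.foldr _+_ 0#

  prodR : List Carrier → Carrier
  prodR = L.foldr _*_ 1#

  powR : Carrier → ℕ → Carrier
  powR x zero = 1#
  powR x (suc n) = x * powR x n

  ℕ→R : ℕ → Carrier
  ℕ→R zero = 0#
  ℕ→R (suc n) = 1# + ℕ→R n

  when : Bool → Carrier → Carrier
  when b x = if b then x else 1#

  Qhat : (lam : Carrier) (a : ℕ → Carrier) (b c d : ℕ → ℕ → Carrier) (e f : ℕ → Carrier)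
       → ℕ → Carrier
  Qhat lam a b c d e f n = sumR (L.map weight (Dperms n))
    where
    weight : Vec (Fin (2 ℕ.* n)) (2 ℕ.* n) → Carrier
    weight σ = powR lam (cyc σ) * prodR (L.map w (allFin (2 ℕ.* n)))
      where
      w : Fin (2 ℕ.* n) → Carrier
      w i = when (isCval σ i) (a (ucross σ i ℕ.+ unest σ i))
          * (when (isCpeak σ i) (b (lcross σ i) (lnest σ i))
          * (when (isCdfall σ i) (c (lcross σ i) (lnest σ i))
          * (when (isCdrise σ i) (d (ucross σ i) (unest σ i))
          * (when (isEvenfix σ i) (e (psnest σ i))
          * when (isOddfix σ i) (f (psnest σ i))))))

  Series : Set c
  Series = ℕ → Carrier

  oneS : Series
  oneS zero = 1#
  oneS (suc _) = 0#

  -- coefficients u_n, …, u_0 of u = 1/(1 - t·h), i.e. u = 1 + t·h·u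
  invVec : Series → (n : ℕ) → Vec Carrier (suc n)
  invVec h zero = 1# ∷ []
  invVec h (suc n) = sumR (V.toList (V.zipWith _*_ (tabulate (λ j → h (toℕ j))) us)) ∷ us
    where us = invVec h n

  -- the series 1/(1 - t·h)
  invS : Series → Series
  invS h n = V.head (invVec h n)

  -- truncated J-fraction: level k, depth m;
  -- cf k (suc m) = 1 / (1 - δ_k t - α_k t · cf (k+1) m),  cf k 0 = 1
  Jfrac : (α δ : ℕ → Carrier) → ℕ → ℕ → Series
  Jfrac α δ k zero = oneS
  Jfrac α δ k (suc m) = invS (λ j → (if eqB j 0 then δ k else 0#) + α k * Jfrac α δ (suc k) m j)

  module _ (lam : Carrier) (a : ℕ → Carrier) (b c d : ℕ → ℕ → Carrier) (e f : ℕ → Carrier) where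
    αOdd : ℕ → Carrier
    αOdd k = (lam + ℕ→R (k ∸ 1)) * a (k ∸ 1)
             * sumR (L.map (λ ξ → b (k ∸ 1 ∸ ξ) ξ) (upTo k))
    αEven : ℕ → Carrier
    αEven k = (lam * e k + sumR (L.map (λ ξ → c (k ∸ 1 ∸ ξ) ξ) (upTo k)))
            * (lam * f k + sumR (L.map (λ ξ → d (k ∸ 1 ∸ ξ) ξ) (upTo k)))
    αcoef : ℕ → Carrier
    αcoef n = if evenB n then αEven ⌊ n /2⌋ else αOdd ⌊ suc n /2⌋
    δcoef : ℕ → Carrier
    δcoef n = if eqB n 1 then lam * lam * e 0 * f 0 else 0#

{-# OPTIONS --safe #-}

-- A D-permutation σ is chosen one value at a time.  First fix the kind of every position; this
-- determines a lattice path whose height at i is the number of j < i with σ(j) > i.  Then choose the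
-- values at the deficiencies from left to right and the remaining ones from right to left.  In this
-- order the weight attached to a position depends only on the choices made before, and the rank of the
-- chosen value among the free ones is the crossing or nesting number.  Summing out the last choice
-- first replaces every position by a factor depending only on the height.  At a cycle valley exactly
-- one of the free values closes a cycle, which yields λ + k − 1.  So the sum over D-permutations is a
-- sum over lattice paths, and these are enumerated by the continued fraction because first-passage
-- products of its tails satisfy the recurrence of the path sums.
module Submission where

open import Defs
open import Level using (Level)
open import Algebra.Bundles using (CommutativeMonoid; CommutativeRing)
open import Data.Bool using (Bool; true; false; T; if_then_else_; not; _∧_; _∨_)
open import Data.Bool.Properties using (T?; T-∧; T-∨; T-≡; T-not-≡; not-involutive)
open import Data.Empty using (⊥)
open import Data.Fin as F using (Fin; zero; suc; toℕ)
open import Data.Fin.Patterns using (0F; 1F; 2F)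
import Data.Fin.Properties as FP
open import Data.List as L using (List; []; _∷_; _++_; allFin; applyUpTo; concatMap; filterᵇ; upTo)
open import Data.List.Membership.Propositional using (_∈_)
import Data.List.Membership.Propositional.Properties as MemP
import Data.List.Properties as LP
open import Data.List.Relation.Binary.Permutation.Propositional as Perm using (_↭_; ↭-sym; ↭-trans; prep)
import Data.List.Relation.Binary.Permutation.Propositional.Properties as PermP
open import Data.List.Relation.Unary.All as All using (All; []; _∷_)
import Data.List.Relation.Unary.All.Properties as AllP
open import Data.List.Relation.Unary.AllPairs as AllPairs using (AllPairs; []; _∷_)
import Data.List.Relation.Unary.AllPairs.Properties as AllPairsP
open import Data.List.Relation.Unary.Any using (here; there)
open import Data.Nat as ℕ using (ℕ; zero; suc; pred; _∸_; _<_; _≤_; z≤n; s≤s; ⌊_/2⌋)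
import Data.Nat.Properties as ℕP
open import Data.Nat.Solver using (module +-*-Solver)
open import Data.Product using (∃; _×_; _,_; proj₁; proj₂)
open import Data.Sum using (_⊎_; inj₁; inj₂)
open import Data.Unit using (⊤; tt)
open import Data.Vec as V using (Vec; []; _∷_; lookup; _[_]≔_)
import Data.Vec.Properties as VP
open import Function using (_∘_; mk⇔; Equivalence)
open import Relation.Binary using (tri<; tri≈; tri>)
open import Relation.Binary.PropositionalEquality as ≡ using (_≡_; _≢_; cong; cong₂; subst)
open import Relation.Nullary using (¬_; Dec; yes; no; does; contradiction)
open import Relation.Nullary.Decidable
  using (_×-dec_; ¬?; toWitness; fromWitness; does-⇔; dec-true; dec-false; isYes≗does)

-- Counting and sums over finite sets

-- The obstacle is `cyc`: crossings and nestings only compare with position `i`, but the number of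
-- cycles is global. Each cycle is charged to its minimum, which is a cycle valley or a fixed point.
-- When the turn of a valley `i` comes, every point above `i` already has its image, so each
-- candidate value starts a determined walk through points above `i`; it closes a cycle with minimum
-- `i` exactly when this walk comes back to `i`. The weight `a` sees only `ucross + unest`, one less
-- than the number of free values whatever the choice, so λ is not entangled with the rank of the
-- value; hence `a` has one index where `b`, `c`, `d` have two. Heights change only at valleys,
-- which are odd, and peaks, which are even. Taking parity into account gives levels that change at
-- every position: height h is level 2h before an odd position and 2h - 1 before an even one. Each α
-- is the weight of a step up together with its return, and δ at 1 is the excursion from level 0 to
-- level -1.

module SumLemmas {c ℓ} (M : CommutativeMonoid c ℓ) where
  open CommutativeMonoid M
  open import Algebra.Properties.CommutativeMonoid.Sum M

  sum-zero : ∀ {n} (t : Fin n → Carrier) → (∀ i → t i ≈ ε) → sum t ≈ ε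
  sum-zero {n} t h = trans (sum-cong-≋ h) (sum-replicate-zero n)

  sum-single : ∀ {n} (k : Fin n) (t : Fin n → Carrier) → (∀ i → i ≢ k → t i ≈ ε) → sum t ≈ t k
  sum-single zero t h =
    trans (∙-congˡ (sum-zero (t ∘ suc) (λ i → h (suc i) λ ()))) (identityʳ _)
  sum-single (suc k) t h =
    trans (∙-cong (h zero λ ()) (sum-single k (t ∘ suc) λ i i≢k → h (suc i) (i≢k ∘ FP.suc-injective)))
          (identityˡ _)

open import Algebra.Properties.Semiring.Sum ℕP.+-*-semiring
  using (sum; sum-cong-≗; ∑-distrib-+; ∑-comm)
open SumLemmas ℕP.+-0-commutativeMonoid using (sum-zero; sum-single)

private variable
  X Y : Set
  m n : ℕ

⟦_⟧ : Dec X → ℕ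
⟦ a? ⟧ = if does a? then 1 else 0

⟦⟧-cong : (a? : Dec X) (b? : Dec Y) → (X → Y) → (Y → X) → ⟦ a? ⟧ ≡ ⟦ b? ⟧
⟦⟧-cong (yes _) (yes _) to from = ≡.refl
⟦⟧-cong (yes a) (no ¬b) to from = contradiction (to a) ¬b
⟦⟧-cong (no ¬a) (yes b) to from = contradiction (from b) ¬a
⟦⟧-cong (no _)  (no _)  to from = ≡.refl

⟦⟧-zero : (a? : Dec X) → ¬ X → ⟦ a? ⟧ ≡ 0
⟦⟧-zero (yes a) ¬a = contradiction a ¬a
⟦⟧-zero (no _)  ¬a = ≡.refl

# : {P : Fin n → Set} → (∀ i → Dec (P i)) → ℕ
# P? = sum (λ i → ⟦ P? i ⟧)

module _ {P Q : Fin n → Set} (P? : ∀ i → Dec (P i)) (Q? : ∀ i → Dec (Q i)) where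
  #-cong : (∀ i → P i → Q i) → (∀ i → Q i → P i) → # P? ≡ # Q?
  #-cong to from = sum-cong-≗ (λ i → ⟦⟧-cong (P? i) (Q? i) (to i) (from i))

module _ {P : Fin n → Set} (P? : ∀ i → Dec (P i)) where
  #-empty : (∀ i → ¬ P i) → # P? ≡ 0
  #-empty h = sum-zero _ (λ i → ⟦⟧-zero (P? i) (h i))

#-positive : {P : Fin n → Set} (P? : ∀ i → Dec (P i)) → ∀ i → P i → 0 < # P?
#-positive P? zero h with P? zero
... | yes _ = s≤s z≤n
... | no ¬h = contradiction h ¬h
#-positive P? (suc i) h = ℕP.<-≤-trans (#-positive (P? ∘ suc) i h) (ℕP.m≤n+m _ ⟦ P? zero ⟧)

#≡0⇒ : {P : Fin n → Set} (P? : ∀ i → Dec (P i)) → # P? ≡ 0 → ∀ i → ¬ P i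
#≡0⇒ P? e i h = ℕP.<-irrefl (≡.sym e) (#-positive P? i h)

#below #above : {P : Fin n → Set} → (∀ i → Dec (P i)) → Fin n → ℕ
#below P? v = # (λ u → (u F.<? v) ×-dec P? u)
#above P? v = # (λ u → (v F.<? u) ×-dec P? u)

#below-zero : {P : Fin (suc n) → Set} (P? : ∀ i → Dec (P i)) → #below P? zero ≡ 0
#below-zero {n} P? = sum-zero {n = suc n} _ (λ _ → ≡.refl)

#-split : {P : Fin n → Set} (P? : ∀ i → Dec (P i)) → ∀ v → P v →
          suc (#below P? v ℕ.+ #above P? v) ≡ # P?
#-split {n = suc n} P? zero h with P? zero
... | yes _ = cong suc (cong (ℕ._+ # (P? ∘ suc)) (#below-zero {n} (λ _ → yes tt)))
... | no ¬h = contradiction h ¬h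
#-split P? (suc v) h = ≡.trans (≡.sym (ℕP.+-suc _ _)) (≡.trans (ℕP.+-assoc ⟦ P? zero ⟧ _ _)
  (cong (⟦ P? zero ⟧ ℕ.+_) (≡.trans (ℕP.+-suc _ _) (#-split (P? ∘ suc) v h))))

Hit : (Fin m → Set) → (Fin m → Fin n) → Fin n → Set
Hit K f v = ∃ λ k → K k × f k ≡ v

module _ {K : Fin m → Set} (K? : ∀ k → Dec (K k)) (f : Fin m → Fin n) where

  hit? : ∀ v → Dec (Hit K f v)
  hit? v = FP.any? (λ k → K? k ×-dec (f k FP.≟ v))

  #-hit : {V : Fin n → Set} (V? : ∀ v → Dec (V v)) →
          (∀ {i j} → K i → K j → f i ≡ f j → i ≡ j) →
          # V? ≡ # (λ v → V? v ×-dec ¬? (hit? v)) ℕ.+ # (λ k → K? k ×-dec V? (f k))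
  #-hit {V} V? inj = begin
    -- Double counting of the pairs with `f k ≡ v`: injectivity on `K` gives each hit value exactly
    -- one preimage in `K`, so summing over `v` or over `k` gives the same number.
    # V?                                            ≡⟨ sum-cong-≗ fibre ⟩
    sum (λ v → free v ℕ.+ sum (λ k → E k v))        ≡⟨ ∑-distrib-+ free (λ v → sum (λ k → E k v)) ⟩
    sum free ℕ.+ sum (λ v → sum (λ k → E k v))      ≡⟨ cong (sum free ℕ.+_) (∑-comm (λ v k → E k v)) ⟩
    sum free ℕ.+ sum (λ k → sum (λ v → E k v))      ≡⟨ cong (sum free ℕ.+_) (sum-cong-≗ image) ⟩
    sum free ℕ.+ # (λ k → K? k ×-dec V? (f k))      ∎
    where
    open ≡.≡-Reasoning
    E? : ∀ k v → Dec ((K k × V (f k)) × f k ≡ v)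
    E? k v = (K? k ×-dec V? (f k)) ×-dec (f k FP.≟ v)
    E : Fin m → Fin n → ℕ
    E k v = ⟦ E? k v ⟧
    free : Fin n → ℕ
    free v = ⟦ V? v ×-dec ¬? (hit? v) ⟧
    image : ∀ k → sum (λ v → E k v) ≡ ⟦ K? k ×-dec V? (f k) ⟧
    image k = ≡.trans
      (sum-single (f k) (E k) (λ v v≢ → ⟦⟧-zero (E? k v) (λ h → v≢ (≡.sym (proj₂ h)))))
      (⟦⟧-cong (E? k (f k)) (K? k ×-dec V? (f k)) proj₁ (λ h → h , ≡.refl))
    fibre : ∀ v → ⟦ V? v ⟧ ≡ free v ℕ.+ sum (λ k → E k v)
    fibre v with hit? v
    ... | yes H@(k₀ , K₀ , ≡.refl) = begin
          ⟦ V? v ⟧            ≡⟨ ⟦⟧-cong (V? v) (E? k₀ v) (λ x → (K₀ , x) , ≡.refl) (proj₂ ∘ proj₁) ⟩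
          E k₀ v              ≡⟨ sum-single k₀ (λ k → E k v) (λ k k≢ → ⟦⟧-zero (E? k v)
                                  (λ x → k≢ (inj (proj₁ (proj₁ x)) K₀ (proj₂ x)))) ⟨
          sum (λ k → E k v)   ≡⟨ cong (ℕ._+ sum (λ k → E k v)) (⟦⟧-zero (V? v ×-dec ¬? (yes H)) (λ x → proj₂ x H)) ⟨
          ⟦ V? v ×-dec ¬? (yes H) ⟧ ℕ.+ sum (λ k → E k v) ∎
    ... | no ¬h = begin
          ⟦ V? v ⟧                ≡⟨ ⟦⟧-cong (V? v) (V? v ×-dec ¬? (no ¬h)) (λ x → x , ¬h) proj₁ ⟩
          ⟦ V? v ×-dec ¬? (no ¬h) ⟧   ≡⟨ ℕP.+-identityʳ _ ⟨
          ⟦ V? v ×-dec ¬? (no ¬h) ⟧ ℕ.+ 0   ≡⟨ cong (⟦ V? v ×-dec ¬? (no ¬h) ⟧ ℕ.+_) (sum-zero (λ k → E k v) (λ k → ⟦⟧-zero (E? k v)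
                                      (λ x → ¬h (k , proj₁ (proj₁ x) , proj₂ x)))) ⟨
          ⟦ V? v ×-dec ¬? (no ¬h) ⟧ ℕ.+ sum (λ k → E k v) ∎

Inj : (Fin n → Fin n) → Set
Inj f = ∀ {i j} → f i ≡ f j → i ≡ j

module _ {f : Fin n → Fin n} (inj : Inj f) where

  private
    all? : (v : Fin n) → Dec ⊤
    all? _ = yes tt

  -- Double counting with every position and every value gives n = (number of unhit values) + n, so
  -- no value is unhit.
  injective⇒surjective : ∀ v → ∃ λ k → f k ≡ v
  injective⇒surjective v with hit? all? f v
  ... | yes (k , _ , e) = k , e
  ... | no ¬h = contradiction (tt , ¬h) (#≡0⇒ (λ v → all? v ×-dec ¬? (hit? all? f v)) unhit≡0 v)
    where
    unhit≡0 : # (λ v → all? v ×-dec ¬? (hit? all? f v)) ≡ 0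
    unhit≡0 = ℕP.+-cancelʳ-≡ _ _ 0 (≡.sym (#-hit all? f all? (λ _ _ → inj)))

  #-injective : {V : Fin n → Set} (V? : ∀ v → Dec (V v)) → # V? ≡ # (V? ∘ f)
  #-injective V? = ≡.trans (#-hit all? f V? (λ _ _ → inj))
    -- By surjectivity the unhit part is empty, so a count of values becomes a count of positions.
    -- This later turns ranks of values into crossing and nesting numbers.
    (cong (ℕ._+ # (V? ∘ f)) (#-empty (λ v → V? v ×-dec ¬? (hit? all? f v)) λ v h → proj₂ h
      (let k , e = injective⇒surjective v in k , tt , e)))

-- Sums and products in a commutative ring

module RingSums {c ℓ : Level} (R : CommutativeRing c ℓ) where
  open CommutativeRing R hiding (zero)
  open import Algebra.Properties.Semiring.Sum semiring public
    using (*-distribˡ-sum; *-distribʳ-sum)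
    renaming (sum to ∑; sum-cong-≋ to ∑-cong; ∑-comm to ∑-swap; ∑-distrib-+ to ∑-+)
  open import Algebra.Properties.CommutativeMonoid.Sum *-commutativeMonoid public
    using ()
    renaming (sum to ∏; sum-cong-≋ to ∏-cong; ∑-distrib-+ to ∏-*)
  open SumLemmas +-commutativeMonoid public
    renaming (sum-zero to ∑-zero; sum-single to ∑-single)

  ∏-zero : ∀ {n} (t : Fin n → Carrier) k → t k ≈ 0# → ∏ t ≈ 0#
  ∏-zero t zero    h = trans (*-congʳ h) (zeroˡ _)
  ∏-zero t (suc k) h = trans (*-congˡ (∏-zero (t ∘ suc) k h)) (zeroʳ _)

  ∑< : (ℕ → Carrier) → ℕ → Carrier
  ∑< g n = sumR R (L.map g (upTo n))

  private
    ∑<-shift : ∀ (g : ℕ → Carrier) (f : ℕ → ℕ) n → sumR R (L.map g (applyUpTo (suc ∘ f) n)) ≡ sumR R (L.map (g ∘ suc) (applyUpTo f n))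
    ∑<-shift g f zero    = ≡.refl
    ∑<-shift g f (suc n) = cong (g (suc (f 0)) +_) (∑<-shift g (f ∘ suc) n)

  ∑<-suc : ∀ g n → ∑< g (suc n) ≡ g 0 + ∑< (g ∘ suc) n
  ∑<-suc g n = cong (g 0 +_) (∑<-shift g (λ (x : ℕ) → x) n)

  ∑<-last : ∀ g n → ∑< g (suc n) ≈ g n + ∑< g n
  ∑<-last g zero    = refl
  ∑<-last g (suc n) = begin
    ∑< g (suc (suc n))                         ≡⟨ ∑<-suc g (suc n) ⟩
    g 0 + ∑< (g ∘ suc) (suc n)                 ≈⟨ +-congˡ (∑<-last (g ∘ suc) n) ⟩
    g 0 + (g (suc n) + ∑< (g ∘ suc) n)         ≈⟨ +-assoc _ _ _ ⟨
    g 0 + g (suc n) + ∑< (g ∘ suc) n           ≈⟨ +-congʳ (+-comm _ _) ⟩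
    g (suc n) + g 0 + ∑< (g ∘ suc) n           ≈⟨ +-assoc _ _ _ ⟩
    g (suc n) + (g 0 + ∑< (g ∘ suc) n)         ≡⟨ cong (g (suc n) +_) (∑<-suc g n) ⟨
    g (suc n) + ∑< g (suc n) ∎
    where open import Relation.Binary.Reasoning.Setoid setoid

  -- The ranks of the members of `P` are 0, 1, 2, ..., each once: the smallest member has rank 0 and
  -- raises all other ranks by one.
  ∑-rank-below : ∀ {n} {P : Fin n → Set} (P? : ∀ i → Dec (P i)) g →
    ∑ (λ v → if does (P? v) then g (#below P? v) else 0#) ≈ ∑< g (# P?)
  ∑-rank-below {zero}  P? g = refl
  ∑-rank-below {suc n} P? g with P? zero
  ... | no _  = trans (+-identityˡ _) (∑-rank-below (P? ∘ suc) g)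
  ... | yes _ = trans (+-cong (reflexive (cong g (#below-zero {n} (λ _ → yes tt)))) (∑-rank-below (P? ∘ suc) (g ∘ suc)))
                      (reflexive (≡.sym (∑<-suc g (# (P? ∘ suc)))))

  -- Counted from above, the smallest member has the top rank, so the last term is the one split
  -- off.
  ∑-rank-above : ∀ {n} {P : Fin n → Set} (P? : ∀ i → Dec (P i)) g →
    ∑ (λ v → if does (P? v) then g (#above P? v) else 0#) ≈ ∑< g (# P?)
  ∑-rank-above {zero}  P? g = refl
  ∑-rank-above {suc n} P? g with P? zero
  ... | no _  = trans (+-identityˡ _) (∑-rank-above (P? ∘ suc) g)
  ... | yes _ = trans (+-congˡ (∑-rank-above (P? ∘ suc) g)) (sym (∑<-last g (# (P? ∘ suc))))

-- Kinds of positions and the order of choices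

data Kind : Set where
  cval cdrise oddfix cpeak cdfall evenfix : Kind

-- `up` and `down` tell on which side of `i` the image σ(i) lies, `above` and `below` on which side
-- the preimage lies. At fixed points all four are false.
up down below above : Kind → Bool
up cval    = true
up cdrise  = true
up _       = false
down cpeak  = true
down cdfall = true
down _      = false
below cdrise = true
below cpeak  = true
below _      = false
above cval   = true
above cdfall = true
above _      = false

Up Down Below Above : Kind → Set
Up    k = T (up k)
Down  k = T (down k)
Below k = T (below k)
Above k = T (above k)

up? : ∀ k → Dec (Up k)
up? k = T? (up k)
down? : ∀ k → Dec (Down k)
down? k = T? (down k)
below? : ∀ k → Dec (Below k)
below? k = T? (below k)
above? : ∀ k → Dec (Above k)
above? k = T? (above k)

up⇒¬down : ∀ k → Up k → ¬ Down k
up⇒¬down cval   _ ()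
up⇒¬down cdrise _ ()

module Order {N : ℕ} (κ : Fin N → Kind) where

  -- The deficiencies come first, from left to right, then all other positions from right to left.
  order : Bool → Bool → Fin N → Fin N → Set
  order true  true  k i = k F.< i
  order true  false k i = ⊤
  order false true  k i = ⊥
  order false false k i = i F.< k

  infix 4 _≺_
  _≺_ : Fin N → Fin N → Set
  k ≺ i = order (down (κ k)) (down (κ i)) k i

  _≺?_ : ∀ k i → Dec (k ≺ i)
  k ≺? i with down (κ k) | down (κ i)
  ... | true  | true  = k F.<? i
  ... | true  | false = yes tt
  ... | false | true  = no λ ()
  ... | false | false = i F.<? k

  ≺-irrefl : ∀ i → ¬ i ≺ i
  ≺-irrefl i with down (κ i)
  ... | true  = FP.<-irrefl ≡.refl
  ... | false = FP.<-irrefl ≡.refl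

  ≺-asym : ∀ k i → k ≺ i → ¬ i ≺ k
  ≺-asym k i with down (κ k) | down (κ i)
  ... | true  | true  = FP.<-asym
  ... | true  | false = λ _ ()
  ... | false | true  = λ ()
  ... | false | false = FP.<-asym

  ≺-connex : ∀ k i → k ≢ i → k ≺ i ⊎ i ≺ k
  ≺-connex k i k≢i with down (κ k) | down (κ i) | FP.<-cmp k i
  ... | _     | _     | tri≈ _ e _ = contradiction e k≢i
  ... | true  | true  | tri< p _ _ = inj₁ p
  ... | true  | true  | tri> _ _ p = inj₂ p
  ... | true  | false | _          = inj₁ tt
  ... | false | true  | _          = inj₂ tt
  ... | false | false | tri< p _ _ = inj₂ p
  ... | false | false | tri> _ _ p = inj₁ p

  down-≺ : ∀ {k i} → Down (κ k) → ¬ Down (κ i) → k ≺ i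
  down-≺ {k} {i} dk ¬di with down (κ k) | down (κ i)
  ... | true | false = tt
  ... | true | true  = contradiction tt ¬di

  -- A deficiency `k` precedes every non-deficiency, and the other positions are taken from right to
  -- left. So a walk confined to points above a non-deficiency `i` uses only values already chosen.
  above-≺ : ∀ {k i} → ¬ Down (κ i) → i F.< k → k ≺ i
  above-≺ {k} {i} ¬di i<k with down (κ k) | down (κ i)
  ... | true  | false = tt
  ... | false | false = i<k
  ... | _     | true  = contradiction tt ¬di

  below-≺ : ∀ {k i} → Down (κ k) → Down (κ i) → k F.< i → k ≺ i
  below-≺ {k} {i} dk di k<i with down (κ k) | down (κ i)
  ... | true | true = k<i

  ≺-down : ∀ {k i} → Down (κ i) → k ≺ i → Down (κ k) × k F.< i
  ≺-down {k} {i} di k≺i with down (κ k) | down (κ i)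
  ... | true | true = tt , k≺i

  ≺-¬down : ∀ {k i} → ¬ Down (κ k) → k ≺ i → i F.< k
  ≺-¬down {k} {i} ¬dk k≺i with down (κ k) | down (κ i)
  ... | true  | _     = contradiction tt ¬dk
  ... | false | false = k≺i

  -- Admissible values and walks back to a position

  module _ (i : Fin N) (f : Fin N → Fin N) where
    Taken : Fin N → Set
    Taken = Hit (_≺ i) f

    taken? : ∀ v → Dec (Taken v)
    taken? = hit? (_≺? i) f

    -- The values that σ(i) can still take if i is an excedance, respectively a deficiency.
    FreeAbove FreeBelow : Fin N → Set
    FreeAbove v = (i F.< v × Below (κ v)) × ¬ Taken v
    FreeBelow v = (v F.< i × Above (κ v)) × ¬ Taken v

    freeAbove? : ∀ v → Dec (FreeAbove v)
    freeAbove? v = ((i F.<? v) ×-dec below? (κ v)) ×-dec ¬? (taken? v)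
    freeBelow? : ∀ v → Dec (FreeBelow v)
    freeBelow? v = ((v F.<? i) ×-dec above? (κ v)) ×-dec ¬? (taken? v)

    -- The kind is an argument of its own, later instantiated by `κ i`, so that it can be matched
    -- on. A fixed point needs no freeness condition: its kind is neither `Below` nor `Above`, so no
    -- other position can claim its value.
    Allowed : Kind → Fin N → Set
    Allowed cval    = FreeAbove
    Allowed cdrise  = FreeAbove
    Allowed cpeak   = FreeBelow
    Allowed cdfall  = FreeBelow
    Allowed oddfix  = _≡ i
    Allowed evenfix = _≡ i

    allowed? : ∀ k v → Dec (Allowed k v)
    allowed? cval      = freeAbove?
    allowed? cdrise    = freeAbove?
    allowed? cpeak     = freeBelow?
    allowed? cdfall    = freeBelow?
    allowed? oddfix  v = v FP.≟ i
    allowed? evenfix v = v FP.≟ i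

    -- Reach r x: after exactly r steps f leads from x to i, with all earlier points above i.
    Reach : ℕ → Fin N → Set
    Reach zero    x = x ≡ i
    Reach (suc r) x = i F.< x × Reach r (f x)

    reach? : ∀ r x → Dec (Reach r x)
    reach? zero    x = x FP.≟ i
    reach? (suc r) x = (i F.<? x) ×-dec reach? r (f x)

    -- The bound `N` on the number of steps makes this decidable; `reach-<` shows that it excludes
    -- nothing.
    Closes : Fin N → Set
    Closes x = ∃ λ (r : Fin N) → Reach (toℕ r) x

    closes? : ∀ x → Dec (Closes x)
    closes? x = FP.any? (λ r → reach? (toℕ r) x)

    reach-≥ : ∀ r {x} → Reach r x → i F.≤ x
    reach-≥ zero    ≡.refl = FP.≤-refl
    reach-≥ (suc r) (h , _) = ℕP.<⇒≤ h

    reach-unique : ∀ r s {x} → Reach r x → Reach s x → r ≡ s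
    reach-unique zero    zero    p       q        = ≡.refl
    reach-unique zero    (suc s) ≡.refl  (q , _)  = contradiction q (FP.<-irrefl ≡.refl)
    reach-unique (suc r) zero    (p , _) ≡.refl   = contradiction p (FP.<-irrefl ≡.refl)
    reach-unique (suc r) (suc s) (_ , p) (_ , q)  = cong suc (reach-unique r s p q)

    iterate : ℕ → Fin N → Fin N
    iterate zero    x = x
    iterate (suc p) x = iterate p (f x)

    reach-iterate : ∀ p r {x} → Reach (p ℕ.+ r) x → Reach r (iterate p x)
    reach-iterate zero    r h       = h
    reach-iterate (suc p) r (_ , h) = reach-iterate p r h

    -- Among more than `N` points of the walk two coincide, and that point would reach `i` in two
    -- different numbers of steps.
    reach-< : ∀ r {x} → Reach r x → r < N
    reach-< r {x} h with r ℕ.<? N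
    ... | yes r<N = r<N
    ... | no  r≮N =
      let p , q , p<q , e = FP.pigeonhole (s≤s (ℕP.≮⇒≥ r≮N)) (λ (j : Fin (suc r)) → iterate (toℕ j) x)
          at = λ (j : Fin (suc r)) → reach-iterate (toℕ j) (r ∸ toℕ j)
                 (subst (λ s → Reach s x) (≡.sym (ℕP.m+[n∸m]≡n (FP.toℕ≤pred[n] j))) h)
          same = reach-unique (r ∸ toℕ p) (r ∸ toℕ q) (at p) (subst (Reach (r ∸ toℕ q)) (≡.sym e) (at q))
      in contradiction (ℕP.∸-cancelˡ-≡ (FP.toℕ≤pred[n] p) (FP.toℕ≤pred[n] q) same) (ℕP.<⇒≢ p<q)

    reach⇒closes : ∀ r {x} → Reach r x → Closes x
    reach⇒closes r {x} h = F.fromℕ< r<N , subst (λ s → Reach s x) (≡.sym (FP.toℕ-fromℕ< r<N)) h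
      where r<N = reach-< r h

  Ok : (Fin N → Fin N) → Fin N → Set
  Ok f i = Allowed i f (κ i) (f i)

  ok? : ∀ f i → Dec (Ok f i)
  ok? f i = allowed? i f (κ i) (f i)

  -- For an admissible σ, `heightAbove i` counts the excedance arcs with j ≤ i < σ(j), as endpoints
  -- minus starts to the right of `i`, and `heightBelow i` the deficiency arcs with σ(j) < i ≤ j.
  -- Both include an arc starting at `i` itself.
  heightAbove heightBelow : Fin N → ℕ
  heightAbove i = #above (below? ∘ κ) i ∸ #above (up? ∘ κ) i
  heightBelow i = #below (above? ∘ κ) i ∸ #below (down? ∘ κ) i

  module _ {i : Fin N} {f : Fin N → Fin N} {v : Fin N} where
    allowed-up : ∀ k → Up k → Allowed i f k v → FreeAbove i f v
    allowed-up cval   _ o = o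
    allowed-up cdrise _ o = o

    allowed-down : ∀ k → Down k → Allowed i f k v → FreeBelow i f v
    allowed-down cpeak  _ o = o
    allowed-down cdfall _ o = o

    allowed-fix : ∀ k → ¬ Up k → ¬ Down k → Allowed i f k v → v ≡ i
    allowed-fix cval    ¬u ¬d o = contradiction tt ¬u
    allowed-fix cdrise  ¬u ¬d o = contradiction tt ¬u
    allowed-fix cpeak   ¬u ¬d o = contradiction tt ¬d
    allowed-fix cdfall  ¬u ¬d o = contradiction tt ¬d
    allowed-fix oddfix  ¬u ¬d o = o
    allowed-fix evenfix ¬u ¬d o = o

  fix⇒¬below : ∀ k → ¬ Up k → ¬ Down k → ¬ Below k
  fix⇒¬below cdrise ¬u ¬d _ = ¬u tt
  fix⇒¬below cpeak  ¬u ¬d _ = ¬d tt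

  fix⇒¬above : ∀ k → ¬ Up k → ¬ Down k → ¬ Above k
  fix⇒¬above cval   ¬u ¬d _ = ¬u tt
  fix⇒¬above cdfall ¬u ¬d _ = ¬d tt

  below⇒¬above : ∀ k → Below k → ¬ Above k
  below⇒¬above cdrise _ ()
  below⇒¬above cpeak  _ ()

  module _ {f : Fin N → Fin N} where

    ok-below : ∀ {k} → Ok f k → Below (κ (f k)) → Up (κ k)
    ok-below {k} o b with up? (κ k) | down? (κ k)
    ... | yes u | _      = u
    ... | no _  | yes d  = contradiction (proj₂ (proj₁ (allowed-down _ d o))) (below⇒¬above _ b)
    ... | no ¬u | no ¬d  = contradiction (subst (Below ∘ κ) (allowed-fix _ ¬u ¬d o) b) (fix⇒¬below (κ k) ¬u ¬d)

    ok-above : ∀ {k} → Ok f k → Above (κ (f k)) → Down (κ k)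
    ok-above {k} o a with up? (κ k) | down? (κ k)
    ... | _     | yes d  = d
    ... | yes u | no _   = contradiction a (below⇒¬above _ (proj₂ (proj₁ (allowed-up _ u o))))
    ... | no ¬u | no ¬d  = contradiction (subst (Above ∘ κ) (allowed-fix _ ¬u ¬d o) a) (fix⇒¬above (κ k) ¬u ¬d)

    private
      ok-distinct : ∀ {k l} → Ok f k → Ok f l → k ≺ l → f k ≢ f l
      ok-distinct {k} {l} ok ol k≺l e with up? (κ l) | down? (κ l)
      ... | yes u | _     = proj₂ (allowed-up _ u ol) (k , k≺l , e)
      ... | no _  | yes d = proj₂ (allowed-down _ d ol) (k , k≺l , e)
      ... | no ¬u | no ¬d with up? (κ k) | down? (κ k)
      ...   | yes u | _      = fix⇒¬below (κ l) ¬u ¬d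
              (subst (Below ∘ κ) (≡.trans e (allowed-fix _ ¬u ¬d ol)) (proj₂ (proj₁ (allowed-up _ u ok))))
      ...   | no _  | yes d  = fix⇒¬above (κ l) ¬u ¬d
              (subst (Above ∘ κ) (≡.trans e (allowed-fix _ ¬u ¬d ol)) (proj₂ (proj₁ (allowed-down _ d ok))))
      ...   | no ¬u′ | no ¬d′ = ≺-irrefl l
              (subst (_≺ l) (≡.trans (≡.sym (allowed-fix _ ¬u′ ¬d′ ok)) (≡.trans e (allowed-fix _ ¬u ¬d ol))) k≺l)

    -- If the later of two positions is an excedance or a deficiency, it avoids all values taken
    -- before. If it is a fixed point, the kind of its value is neither `Below` nor `Above`, so only
    -- a fixed point could share it.
    ok-injective : ∀ {k l} → Ok f k → Ok f l → f k ≡ f l → k ≡ l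
    ok-injective {k} {l} ok ol e with k FP.≟ l
    ... | yes k≡l = k≡l
    ... | no  k≢l with ≺-connex k l k≢l
    ...   | inj₁ k≺l = contradiction e (ok-distinct ok ol k≺l)
    ...   | inj₂ l≺k = contradiction (≡.sym e) (ok-distinct ol ok l≺k)

  -- Counting the free values and the closing values

  module _ {f : Fin N → Fin N} {i : Fin N} (pre : ∀ k → k ≺ i → Ok f k) where

    private
      pre-inj : ∀ {k l} → k ≺ i → l ≺ i → f k ≡ f l → k ≡ l
      pre-inj p q = ok-injective (pre _ p) (pre _ q)

    #-freeAbove : ¬ Down (κ i) → # (freeAbove? i f) ≡ heightAbove i
    #-freeAbove ¬di = ≡.sym (≡.trans (cong (_∸ #above (up? ∘ κ) i) split) (ℕP.m+n∸n≡m _ (#above (up? ∘ κ) i)))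
      where
      V? : ∀ v → Dec (i F.< v × Below (κ v))
      V? v = (i F.<? v) ×-dec below? (κ v)
      -- The values already taken here are those of the excedances right of `i`: these precede `i`,
      -- and their values lie beyond `i` automatically.
      split : # V? ≡ # (freeAbove? i f) ℕ.+ #above (up? ∘ κ) i
      split = ≡.trans (#-hit (_≺? i) f V? pre-inj) (cong (# (freeAbove? i f) ℕ.+_)
        (#-cong (λ k → (k ≺? i) ×-dec V? (f k)) (λ k → (i F.<? k) ×-dec up? (κ k))
          (λ k (k≺i , i<fk , b) → let u = ok-below (pre k k≺i) b in ≺-¬down (up⇒¬down _ u) k≺i , u)
          (λ k (i<k , u) → let k≺i = above-≺ ¬di i<k ; (k<fk , b) , _ = allowed-up _ u (pre k k≺i)
                           in k≺i , FP.<-trans i<k k<fk , b)))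

    #-freeBelow : Down (κ i) → # (freeBelow? i f) ≡ heightBelow i
    #-freeBelow di = ≡.sym (≡.trans (cong (_∸ #below (down? ∘ κ) i) split) (ℕP.m+n∸n≡m _ (#below (down? ∘ κ) i)))
      where
      V? : ∀ v → Dec (v F.< i × Above (κ v))
      V? v = (v F.<? i) ×-dec above? (κ v)
      -- Here they are those of the deficiencies left of `i`, whose values lie left of `i`
      -- automatically.
      split : # V? ≡ # (freeBelow? i f) ℕ.+ #below (down? ∘ κ) i
      split = ≡.trans (#-hit (_≺? i) f V? pre-inj) (cong (# (freeBelow? i f) ℕ.+_)
        (#-cong (λ k → (k ≺? i) ×-dec V? (f k)) (λ k → (k F.<? i) ×-dec down? (κ k))
          (λ k (k≺i , _) → let d , k<i = ≺-down di k≺i in k<i , d)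
          (λ k (k<i , d) → let k≺i = below-≺ d di k<i ; (fk<k , a) , _ = allowed-down _ d (pre k k≺i)
                           in k≺i , FP.<-trans fk<k k<i , a)))

    reach-injective : ¬ Down (κ i) → ∀ r {x y} → Reach i f r x → Reach i f r y → x ≡ y
    reach-injective ¬di zero    p q = ≡.trans p (≡.sym q)
    reach-injective ¬di (suc r) (i<x , p) (i<y , q) =
      pre-inj (above-≺ ¬di i<x) (above-≺ ¬di i<y) (reach-injective ¬di r p q)

    private
      reach-free : ¬ Down (κ i) → ∀ d r {x y} → FreeAbove i f x → Reach i f r x → Reach i f (d ℕ.+ r) y → x ≡ y
      reach-free ¬di zero    r fx p q = reach-injective ¬di r p q
      reach-free ¬di (suc d) r {x} {y} fx p (i<y , q) = contradiction (last d i<y q) (proj₂ fx)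
        where
        last : ∀ d {y} → i F.< y → Reach i f (d ℕ.+ r) (f y) → Taken i f x
        last zero    {y} i<y q       = y , above-≺ ¬di i<y , reach-injective ¬di r q p
        last (suc d) {y} i<y (i<fy , q) = last d i<fy q

    -- If two free values reached `i` after different numbers of steps, the longer walk would run
    -- into the start of the shorter one. That start would be the image of a point above `i`, hence
    -- taken.
    closing-unique : ¬ Down (κ i) → ∀ {x y} → FreeAbove i f x → FreeAbove i f y →
                     Closes i f x → Closes i f y → x ≡ y
    closing-unique ¬di fx fy (r , p) (s , q) with ℕP.≤-total (toℕ r) (toℕ s)
    ... | inj₁ r≤s = reach-free ¬di (toℕ s ∸ toℕ r) (toℕ r) fx p
                       (subst (λ t → Reach i f t _) (≡.sym (ℕP.m∸n+n≡m r≤s)) q)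
    ... | inj₂ s≤r = ≡.sym (reach-free ¬di (toℕ r ∸ toℕ s) (toℕ s) fy q
                       (subst (λ t → Reach i f t _) (≡.sym (ℕP.m∸n+n≡m s≤r)) p))

    -- All deficiencies are chosen before a non-deficiency. They map injectively into the
    -- above-values, and `balanced` says that there are equally many of both.
    above-taken : ¬ Down (κ i) → # (above? ∘ κ) ≡ # (down? ∘ κ) →
                  ∀ v → Above (κ v) → Hit (Down ∘ κ) f v
    above-taken ¬di balanced v a with hit? (down? ∘ κ) f v
    ... | yes h = h
    ... | no ¬h = contradiction (a , ¬h) (#≡0⇒ (λ v → above? (κ v) ×-dec ¬? (hit? (down? ∘ κ) f v)) free≡0 v)
      where
      pre-down : ∀ k → Down (κ k) → Ok f k
      pre-down k d = pre k (down-≺ d ¬di)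
      free≡0 : # (λ v → above? (κ v) ×-dec ¬? (hit? (down? ∘ κ) f v)) ≡ 0
      free≡0 = ℕP.+-cancelʳ-≡ _ _ 0 (≡.trans
        (≡.sym (#-hit (down? ∘ κ) f (above? ∘ κ) (λ p q → ok-injective (pre-down _ p) (pre-down _ q))))
        (≡.trans balanced (#-cong (down? ∘ κ) (λ k → down? (κ k) ×-dec above? (κ (f k)))
          (λ k d → d , proj₂ (proj₁ (allowed-down _ d (pre-down k d)))) (λ k → proj₁))))

    -- Walk backwards from i along the values chosen so far; the walk cannot cycle, so it stops at a free value.
    closing-exists : κ i ≡ cval → # (above? ∘ κ) ≡ # (down? ∘ κ) →
                     ∃ λ v → FreeAbove i f v × Closes i f v
    -- Each step back trades one unit of `fuel` for one of `r`, so exhausted fuel means `N ≤ r`,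
    -- against `reach-<`.
    closing-exists κi balanced = walk N 0 (ℕP.≤-reflexive (≡.sym (ℕP.+-identityʳ N))) ≡.refl
      where
      ¬di : ¬ Down (κ i)
      ¬di d = subst Down κi d
      pred-below : ∀ {x} → i F.≤ x → Above (κ x) → ∃ λ k → i F.< k × f k ≡ x
      pred-below i≤x a with above-taken ¬di balanced _ a
      ... | k , d , ≡.refl = k , ℕP.≤-<-trans i≤x (proj₁ (proj₁ (allowed-down _ d (pre k (down-≺ d ¬di))))) , ≡.refl
      walk : ∀ fuel r {x} → N ≤ fuel ℕ.+ r → Reach i f r x → ∃ λ v → FreeAbove i f v × Closes i f v
      walk zero r N≤r h = contradiction N≤r (ℕP.<⇒≱ (reach-< i f r h))
      walk (suc fuel) r {x} le h with above? (κ x)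
      ... | yes a with pred-below (reach-≥ i f r h) a
      ...   | k , i<k , ≡.refl = walk fuel (suc r) (ℕP.≤-trans le (ℕP.≤-reflexive (≡.sym (ℕP.+-suc fuel r)))) (i<k , h)
      walk (suc fuel) zero {x} le ≡.refl | no ¬a = contradiction (subst Above (≡.sym κi) tt) ¬a
      walk (suc fuel) (suc r) {x} le (i<x , h) | no ¬a with below? (κ x) | taken? i f x
      ... | yes b | no ¬t = x , ((i<x , b) , ¬t) , reach⇒closes i f (suc r) (i<x , h)
      ... | yes b | yes (k , k≺i , ≡.refl) = walk fuel (suc (suc r)) (ℕP.≤-trans le (ℕP.≤-reflexive (≡.sym (ℕP.+-suc fuel (suc r)))))
              (≺-¬down (up⇒¬down _ (ok-below (pre k k≺i) b)) k≺i , i<x , h)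
      -- Such an `x` is a fixed point, from which `i` would be reached in both `r` and `r + 1`
      -- steps.
      ... | no ¬b | _ = contradiction (reach-unique i f r (suc r) h (subst (Reach i f (suc r)) (≡.sym fx≡x) (i<x , h))) (ℕP.<⇒≢ (ℕP.n<1+n r))
        where
        fixed : ∀ k → ¬ Below k → ¬ Above k → ¬ Up k × ¬ Down k
        fixed cval    ¬b ¬a = contradiction tt ¬a
        fixed cdrise  ¬b ¬a = contradiction tt ¬b
        fixed cpeak   ¬b ¬a = contradiction tt ¬b
        fixed cdfall  ¬b ¬a = contradiction tt ¬a
        fixed oddfix  ¬b ¬a = (λ ()) , (λ ())
        fixed evenfix ¬b ¬a = (λ ()) , (λ ())
        fx≡x : f x ≡ x
        fx≡x = let ¬u , ¬d = fixed (κ x) ¬b ¬a in allowed-fix _ ¬u ¬d (pre x (above-≺ ¬di i<x))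

-- Sums over vectors

if-cong : ∀ {ℓ} {X : Set ℓ} {A B : Set} {a? : Dec A} {b? : Dec B} {x y z : X} →
          does a? ≡ does b? → x ≡ y → (if does a? then x else z) ≡ (if does b? then y else z)
if-cong {z = z} p q = cong₂ (λ t u → if t then u else z) p q

-- Position 0 comes before all others if it is a deficiency, and after all others if it is not.
choiceOrder : ∀ {N} → (Fin N → Kind) → List (Fin N)
choiceOrder {zero}  κ = []
choiceOrder {suc N} κ with down (κ zero)
... | true  = zero ∷ L.map suc (choiceOrder (κ ∘ suc))
... | false = L.map suc (choiceOrder (κ ∘ suc)) ++ zero ∷ []

choiceOrder-↭ : ∀ {N} (κ : Fin N → Kind) → choiceOrder κ ↭ allFin N
choiceOrder-↭ {zero}  κ = Perm.refl
choiceOrder-↭ {suc N} κ with down (κ zero) | ≡.subst (L.map suc (choiceOrder (κ ∘ suc)) ↭_) (LP.map-tabulate {n = N} (λ i → i) suc)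
                                                (PermP.map⁺ suc (choiceOrder-↭ (κ ∘ suc)))
... | true  | h = prep zero h
... | false | h = ↭-trans (↭-sym (PermP.∷↭∷ʳ zero _)) (prep zero h)

≺-suc : ∀ {N} (κ : Fin (suc N) → Kind) {k i} → Order._≺_ (κ ∘ suc) k i → Order._≺_ κ (suc k) (suc i)
≺-suc κ {k} {i} p with down (κ (suc k)) | down (κ (suc i))
... | true  | true  = s≤s p
... | true  | false = tt
... | false | false = s≤s p

choiceOrder-sorted : ∀ {N} (κ : Fin N → Kind) → AllPairs (Order._≺_ κ) (choiceOrder κ)
choiceOrder-sorted {zero}  κ = []
choiceOrder-sorted {suc N} κ with down (κ zero) in eq
... | true  = AllP.map⁺ (All.universal first _) ∷ AllPairsP.map⁺ (AllPairs.map (≺-suc κ) (choiceOrder-sorted (κ ∘ suc)))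
  where
  first : ∀ i → Order._≺_ κ zero (suc i)
  first i rewrite eq with down (κ (suc i))
  ... | true  = s≤s z≤n
  ... | false = tt
... | false = AllPairsP.++⁺ (AllPairsP.map⁺ (AllPairs.map (≺-suc κ) (choiceOrder-sorted (κ ∘ suc)))) ([] ∷ [])
                (AllP.map⁺ (All.universal (λ k → last k ∷ []) _))
  where
  last : ∀ k → Order._≺_ κ (suc k) zero
  last k rewrite eq with down (κ (suc k))
  ... | true  = tt
  ... | false = s≤s z≤n

module VecSums {c ℓ : Level} (R : CommutativeRing c ℓ) where
  open CommutativeRing R hiding (zero)
  open RingSums R
  open import Relation.Binary.Reasoning.Setoid setoid

  ∑ᵛ : ∀ {k m} → (Vec (Fin m) k → Carrier) → Carrier
  ∑ᵛ {zero}  F = F []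
  ∑ᵛ {suc k} F = ∑ (λ v → ∑ᵛ (λ σ → F (v ∷ σ)))

  ∑ᵛ-cong : ∀ {k m} {F G : Vec (Fin m) k → Carrier} → (∀ σ → F σ ≈ G σ) → ∑ᵛ F ≈ ∑ᵛ G
  ∑ᵛ-cong {zero}  h = h []
  ∑ᵛ-cong {suc k} h = ∑-cong (λ v → ∑ᵛ-cong (λ σ → h (v ∷ σ)))

  ∑ᵛ-zero : ∀ {k m} {F : Vec (Fin m) k → Carrier} → (∀ σ → F σ ≈ 0#) → ∑ᵛ F ≈ 0#
  ∑ᵛ-zero {zero}  h = h []
  ∑ᵛ-zero {suc k} h = ∑-zero _ (λ v → ∑ᵛ-zero (λ σ → h (v ∷ σ)))

  ∑ᵛ-single : ∀ {k m} (τ : Vec (Fin m) k) {F : Vec (Fin m) k → Carrier} →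
              (∀ σ → σ ≢ τ → F σ ≈ 0#) → ∑ᵛ F ≈ F τ
  ∑ᵛ-single []      h = refl
  ∑ᵛ-single (x ∷ τ) h = trans
    (∑-single x _ (λ v v≢x → ∑ᵛ-zero (λ σ → h (v ∷ σ) (v≢x ∘ VP.∷-injectiveˡ))))
    (∑ᵛ-single τ (λ σ σ≢τ → h (x ∷ σ) (σ≢τ ∘ VP.∷-injectiveʳ)))

  ∑-∑ᵛ-swap : ∀ {n k m} (F : Fin n → Vec (Fin m) k → Carrier) →
              ∑ (λ i → ∑ᵛ (F i)) ≈ ∑ᵛ (λ σ → ∑ (λ i → F i σ))
  ∑-∑ᵛ-swap {k = zero}  F = refl
  ∑-∑ᵛ-swap {n} {suc k} {m} F = trans (∑-swap {n} {m} (λ i v → ∑ᵛ (λ σ → F i (v ∷ σ)))) (∑-cong (λ v → ∑-∑ᵛ-swap (λ i σ → F i (v ∷ σ))))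

  ∑ᵛ-swap : ∀ {k m k′ m′} (F : Vec (Fin m) k → Vec (Fin m′) k′ → Carrier) →
            ∑ᵛ (λ σ → ∑ᵛ (F σ)) ≈ ∑ᵛ (λ τ → ∑ᵛ (λ σ → F σ τ))
  ∑ᵛ-swap {zero}  F = refl
  ∑ᵛ-swap {suc k} {m} F = trans (∑-cong (λ v → ∑ᵛ-swap (λ σ → F (v ∷ σ)))) (∑-∑ᵛ-swap {m} (λ v τ → ∑ᵛ (λ σ → F (v ∷ σ) τ)))

  ∑ᵛ-distribˡ : ∀ {k m} x (F : Vec (Fin m) k → Carrier) → ∑ᵛ (λ σ → x * F σ) ≈ x * ∑ᵛ F
  ∑ᵛ-distribˡ {zero}  x F = refl
  ∑ᵛ-distribˡ {suc k} {m} x F = trans (∑-cong (λ v → ∑ᵛ-distribˡ x (λ σ → F (v ∷ σ)))) (sym (*-distribˡ-sum {m} x _))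

  -- The head of the list is the outermost sum, so with positions listed in the order of choice the
  -- last choice is summed out first.
  sumOver : ∀ {k m} → List (Fin k) → (Vec (Fin m) k → Carrier) → Vec (Fin m) k → Carrier
  sumOver []       F σ = F σ
  sumOver (i ∷ is) F σ = ∑ (λ v → sumOver is F (σ [ i ]≔ v))

  sumOver-factor : ∀ {k m} is (h F : Vec (Fin m) k → Carrier) →
                   All (λ i → ∀ σ v → h (σ [ i ]≔ v) ≈ h σ) is →
                   ∀ σ → sumOver is (λ σ → h σ * F σ) σ ≈ h σ * sumOver is F σ
  sumOver-factor []       h F []       σ = refl
  sumOver-factor {m = m} (i ∷ is) h F (p ∷ ps) σ = begin
    ∑ (λ v → sumOver is (λ σ → h σ * F σ) (σ [ i ]≔ v)) ≈⟨ ∑-cong (λ v → sumOver-factor is h F ps (σ [ i ]≔ v)) ⟩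
    ∑ (λ v → h (σ [ i ]≔ v) * sumOver is F (σ [ i ]≔ v)) ≈⟨ ∑-cong (λ v → *-congʳ (p σ v)) ⟩
    ∑ (λ v → h σ * sumOver is F (σ [ i ]≔ v))           ≈⟨ *-distribˡ-sum {m} (h σ) _ ⟨
    h σ * sumOver (i ∷ is) F σ                          ∎

  sumOver-↭ : ∀ {k m} {is js : List (Fin k)} (F : Vec (Fin m) k → Carrier) → is ↭ js →
              ∀ σ → sumOver is F σ ≈ sumOver js F σ
  sumOver-↭ F Perm.refl          σ = refl
  sumOver-↭ F (prep i p)         σ = ∑-cong (λ v → sumOver-↭ F p (σ [ i ]≔ v))
  sumOver-↭ F (Perm.trans p q)   σ = trans (sumOver-↭ F p σ) (sumOver-↭ F q σ)
  sumOver-↭ {m = m} {is = i ∷ j ∷ is} {_ ∷ _ ∷ js} F (Perm.swap i j p) σ with i FP.≟ j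
  -- Two updates at the same position do not commute, but then swapping the heads changes nothing.
  ... | yes ≡.refl = ∑-cong (λ v → ∑-cong (λ w → sumOver-↭ F p (σ [ i ]≔ v [ i ]≔ w)))
  ... | no i≢j = trans (∑-swap {m} {m} (λ v w → sumOver is F (σ [ i ]≔ v [ j ]≔ w)))
        (∑-cong λ w → ∑-cong λ v → trans
          (reflexive (cong (sumOver is F) (≡.sym ([]≔-swap v w)))) (sumOver-↭ F p _))
    where
    []≔-swap : ∀ v w → σ [ j ]≔ w [ i ]≔ v ≡ σ [ i ]≔ v [ j ]≔ w
    []≔-swap v w = VP.[]≔-commutes σ j i (i≢j ∘ ≡.sym)

  sumOver-map-suc : ∀ {k m} is (F : Vec (Fin m) (suc k) → Carrier) x σ →
                    sumOver (L.map suc is) F (x ∷ σ) ≈ sumOver is (λ σ → F (x ∷ σ)) σ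
  sumOver-map-suc []       F x σ = refl
  sumOver-map-suc (i ∷ is) F x σ = ∑-cong (λ v → sumOver-map-suc is F x (σ [ i ]≔ v))

  sumOver-allFin : ∀ {k m} (F : Vec (Fin m) k → Carrier) σ → sumOver (allFin k) F σ ≈ ∑ᵛ F
  sumOver-allFin {zero}  F []      = refl
  sumOver-allFin {suc k} F (x ∷ σ) = ∑-cong λ v → begin
    sumOver (L.tabulate suc) F (v ∷ σ)          ≡⟨ cong (λ is → sumOver is F (v ∷ σ)) (LP.map-tabulate {n = k} (λ i → i) suc) ⟨
    sumOver (L.map suc (allFin k)) F (v ∷ σ)    ≈⟨ sumOver-map-suc (allFin k) F v σ ⟩
    sumOver (allFin k) (λ σ → F (v ∷ σ)) σ      ≈⟨ sumOver-allFin (λ σ → F (v ∷ σ)) σ ⟩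
    ∑ᵛ (λ σ → F (v ∷ σ))                        ∎

  prodOver : ∀ {k} → List (Fin k) → (Fin k → Carrier) → Carrier
  prodOver is t = prodR R (L.map t is)

  prodOver-↭ : ∀ {k} (t : Fin k → Carrier) {is js} → is ↭ js → prodOver is t ≈ prodOver js t
  prodOver-↭ t Perm.refl        = refl
  prodOver-↭ t (prep i p)       = *-congˡ (prodOver-↭ t p)
  prodOver-↭ t (Perm.trans p q) = trans (prodOver-↭ t p) (prodOver-↭ t q)
  prodOver-↭ t (Perm.swap i j p) = begin
    t i * (t j * _) ≈⟨ *-assoc _ _ _ ⟨
    t i * t j * _   ≈⟨ *-cong (*-comm _ _) (prodOver-↭ t p) ⟩
    t j * t i * _   ≈⟨ *-assoc _ _ _ ⟩
    t j * (t i * _) ∎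

  prodOver-allFin : ∀ {k} (t : Fin k → Carrier) → prodOver (allFin k) t ≈ ∏ t
  prodOver-allFin {zero}  t = refl
  prodOver-allFin {suc k} t = *-congˡ (begin
    prodOver (L.tabulate suc) t      ≡⟨ cong (λ is → prodOver is t) (LP.map-tabulate {n = k} (λ i → i) suc) ⟨
    prodOver (L.map suc (allFin k)) t ≡⟨ cong (prodR R) (LP.map-∘ (allFin k)) ⟨
    prodOver (allFin k) (t ∘ suc)    ≈⟨ prodOver-allFin (t ∘ suc) ⟩
    ∏ (t ∘ suc) ∎)

  ∑-count : ∀ {n} {P : Fin n → Set} (P? : ∀ i → Dec (P i)) →
            ∑ (λ v → if does (P? v) then 1# else 0#) ≈ ℕ→R R (# P?)
  ∑-count {zero}  P? = refl
  ∑-count {suc n} P? with P? zero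
  ... | yes _ = +-congˡ (∑-count (P? ∘ suc))
  ... | no _  = trans (+-identityˡ _) (∑-count (P? ∘ suc))

  -- The marked member contributes `x` and every other member of `P` contributes 1. This is the
  -- source of λ + k - 1.
  ∑-one-marked : ∀ {n} {P Q : Fin n → Set} (P? : ∀ i → Dec (P i)) (Q? : ∀ i → Dec (Q i)) x v₀ →
                 P v₀ → Q v₀ → (∀ v → P v → Q v → v ≡ v₀) →
                 ∑ (λ v → if does (P? v) then (if does (Q? v) then x else 1#) else 0#) ≈ x + ℕ→R R (# P? ∸ 1)
  ∑-one-marked {n} {P} {Q} P? Q? x v₀ p q unique = begin
    ∑ (λ v → if does (P? v) then (if does (Q? v) then x else 1#) else 0#) ≈⟨ ∑-cong split ⟩
    ∑ (λ v → marked v + unmarked v)                                ≈⟨ ∑-+ marked unmarked ⟩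
    ∑ marked + ∑ unmarked                                          ≈⟨ +-cong (trans (∑-single v₀ marked others) at-v₀) (∑-count U?) ⟩
    x + ℕ→R R (# U?)                                               ≡⟨ cong (λ k → x + ℕ→R R (k ∸ 1)) count ⟨
    x + ℕ→R R (# P? ∸ 1)                                           ∎
    where
    M? = λ v → P? v ×-dec Q? v
    U? = λ v → P? v ×-dec ¬? (Q? v)
    marked unmarked : Fin n → Carrier
    marked v = if does (M? v) then x else 0#
    unmarked v = if does (U? v) then 1# else 0#
    split : ∀ v → (if does (P? v) then (if does (Q? v) then x else 1#) else 0#) ≈ marked v + unmarked v
    split v with P? v | Q? v
    ... | yes _ | yes _ = sym (+-identityʳ _)
    ... | yes _ | no _  = sym (+-identityˡ _)
    ... | no _  | _     = sym (+-identityˡ _)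
    others : ∀ v → v ≢ v₀ → marked v ≈ 0#
    others v v≢ = reflexive (cong (λ t → if t then x else 0#)
      (dec-false (M? v) (λ (pv , qv) → v≢ (unique v pv qv))))
    at-v₀ : marked v₀ ≈ x
    at-v₀ = reflexive (cong (λ t → if t then x else 0#) (dec-true (M? v₀) (p , q)))
    split-ℕ : ∀ v → ⟦ P? v ⟧ ≡ ⟦ M? v ⟧ ℕ.+ ⟦ U? v ⟧
    split-ℕ v with P? v | Q? v
    ... | yes _ | yes _ = ≡.refl
    ... | yes _ | no _  = ≡.refl
    ... | no _  | _     = ≡.refl
    count : # P? ≡ suc (# U?)
    count = ≡.trans (sum-cong-≗ split-ℕ) (≡.trans (∑-distrib-+ (λ v → ⟦ M? v ⟧) (λ v → ⟦ U? v ⟧))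
      (cong (ℕ._+ # U?) (≡.trans (sum-single v₀ (λ v → ⟦ M? v ⟧) (λ v v≢ → ⟦⟧-zero (M? v) (λ (pv , qv) → v≢ (unique v pv qv))))
        (⟦⟧-cong (M? v₀) (yes tt) (λ _ → tt) (λ _ → p , q)))))

-- Summing out the choices

module Weights {ℓ₁ ℓ₂ : Level} (R : CommutativeRing ℓ₁ ℓ₂)
  (lam : CommutativeRing.Carrier R) (a : ℕ → CommutativeRing.Carrier R)
  (b c d : ℕ → ℕ → CommutativeRing.Carrier R) (e f : ℕ → CommutativeRing.Carrier R) where
  open CommutativeRing R hiding (zero)
  open RingSums R
  open VecSums R
  open import Relation.Binary.Reasoning.Setoid setoid

  -- Empty at `h` = 0, which rules out cyclic rises, cyclic falls and peaks at height zero.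
  antidiagonal : (ℕ → ℕ → Carrier) → ℕ → Carrier
  antidiagonal x h = ∑< (λ ξ → x (h ∸ 1 ∸ ξ) ξ) h

  -- At a valley `ha` also counts the arc opened there, so the height before it is `ha ∸ 1`. At a
  -- cyclic rise or a fixed point `ha` is the height itself.
  total : Kind → ℕ → ℕ → Carrier
  total cval    hb ha = (lam + ℕ→R R (ha ∸ 1)) * a (ha ∸ 1)
  total cdrise  hb ha = antidiagonal d ha
  total oddfix  hb ha = lam * f ha
  total cpeak   hb ha = antidiagonal b hb
  total cdfall  hb ha = antidiagonal c hb
  total evenfix hb ha = lam * e ha

  module Local {N : ℕ} (κ : Fin N → Kind) where
    open Order κ public

    -- Each statistic is expressed by the values free at the moment of choice: the two-index weights
    -- take both ranks of `v`, a valley takes the number of rivals, a fixed point the number of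
    -- excedance arcs above it. λ sits at cycle minima.
    localWeight : Kind → Fin N → (Fin N → Fin N) → Fin N → Carrier
    localWeight cval    i s v = (if does (closes? i s v) then lam else 1#) * a (# (freeAbove? i s) ∸ 1)
    localWeight cdrise  i s v = d (#below (freeAbove? i s) v) (#above (freeAbove? i s) v)
    localWeight oddfix  i s v = lam * f (# (freeAbove? i s))
    localWeight cpeak   i s v = b (#above (freeBelow? i s) v) (#below (freeBelow? i s) v)
    localWeight cdfall  i s v = c (#above (freeBelow? i s) v) (#below (freeBelow? i s) v)
    localWeight evenfix i s v = lam * e (# (freeAbove? i s))

    choiceWeight : Kind → Fin N → (Fin N → Fin N) → Fin N → Carrier
    choiceWeight k i s v = if does (allowed? i s k v) then localWeight k i s v else 0#

    factor : Fin N → (Fin N → Fin N) → Carrier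
    factor i s = choiceWeight (κ i) i s (s i)

    private
      -- The two ranks of a member of `P` add up to `# P? ∸ 1`, so the pair runs along an
      -- antidiagonal.
      ∑-below-above : ∀ {P : Fin N → Set} (P? : ∀ v → Dec (P v)) x →
        ∑ (λ v → if does (P? v) then x (#below P? v) (#above P? v) else 0#) ≈ antidiagonal x (# P?)
      ∑-below-above P? x = trans (∑-cong λ v → reflexive (rewrite-below v)) (∑-rank-above P? (λ ξ → x (# P? ∸ 1 ∸ ξ) ξ))
        where
        rewrite-below : ∀ v → (if does (P? v) then x (#below P? v) (#above P? v) else 0#)
                            ≡ (if does (P? v) then x (# P? ∸ 1 ∸ #above P? v) (#above P? v) else 0#)
        rewrite-below v with P? v
        ... | no _  = ≡.refl
        ... | yes p = cong (λ t → x t (#above P? v)) (≡.trans (≡.sym (ℕP.m+n∸n≡m _ (#above P? v)))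
                        (cong (λ t → t ∸ 1 ∸ #above P? v) (#-split P? v p)))

      ∑-above-below : ∀ {P : Fin N → Set} (P? : ∀ v → Dec (P v)) x →
        ∑ (λ v → if does (P? v) then x (#above P? v) (#below P? v) else 0#) ≈ antidiagonal x (# P?)
      ∑-above-below P? x = trans (∑-cong λ v → reflexive (rewrite-above v)) (∑-rank-below P? (λ ξ → x (# P? ∸ 1 ∸ ξ) ξ))
        where
        rewrite-above : ∀ v → (if does (P? v) then x (#above P? v) (#below P? v) else 0#)
                            ≡ (if does (P? v) then x (# P? ∸ 1 ∸ #below P? v) (#below P? v) else 0#)
        rewrite-above v with P? v
        ... | no _  = ≡.refl
        ... | yes p = cong (λ t → x t (#below P? v)) (≡.trans (≡.sym (ℕP.m+n∸m≡n (#below P? v) _))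
                        (cong (λ t → t ∸ 1 ∸ #below P? v) (#-split P? v p)))

      ∑-fixed : ∀ (i : Fin N) x → ∑ (λ (v : Fin N) → if does (v FP.≟ i) then x else 0#) ≈ x
      ∑-fixed i x = trans
        (∑-single i (λ v → if does (v FP.≟ i) then x else 0#)
          (λ v v≢i → reflexive (cong (λ t → if t then x else 0#) (dec-false (v FP.≟ i) v≢i))))
        (reflexive (cong (λ t → if t then x else 0#) (dec-true (i FP.≟ i) ≡.refl)))

    -- The number of free values does not depend on how the earlier choices were made, so only
    -- heights survive. `balanced` supplies the closing value at a valley.
    ∑-choiceWeight : # (above? ∘ κ) ≡ # (down? ∘ κ) → ∀ i s → (∀ k → k ≺ i → Ok s k) →
      ∑ (λ v → choiceWeight (κ i) i s v) ≈ total (κ i) (heightBelow i) (heightAbove i)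
    ∑-choiceWeight balanced i s pre = byKind (κ i) ≡.refl
      where
      ha : ¬ Down (κ i) → # (freeAbove? i s) ≡ heightAbove i
      ha = #-freeAbove pre
      hb : Down (κ i) → # (freeBelow? i s) ≡ heightBelow i
      hb = #-freeBelow pre
      byKind : ∀ k → κ i ≡ k → ∑ (λ v → choiceWeight k i s v) ≈ total k (heightBelow i) (heightAbove i)
      byKind cval κi = begin
        ∑ (λ v → choiceWeight cval i s v)  ≈⟨ ∑-cong pull ⟩
        ∑ (λ v → t v * w)                  ≈⟨ *-distribʳ-sum {N} w t ⟨
        ∑ t * w                            ≈⟨ *-congʳ marked ⟩
        (lam + ℕ→R R (h ∸ 1)) * a (h ∸ 1)  ≡⟨ cong (λ h → (lam + ℕ→R R (h ∸ 1)) * a (h ∸ 1)) (ha (subst (¬_ ∘ Down) (≡.sym κi) λ ())) ⟩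
        _ ∎
        where
        h = # (freeAbove? i s)
        w = a (h ∸ 1)
        t : Fin N → Carrier
        t v = if does (freeAbove? i s v) then (if does (closes? i s v) then lam else 1#) else 0#
        pull : ∀ v → choiceWeight cval i s v ≈ t v * w
        pull v with does (freeAbove? i s v)
        ... | true  = refl
        ... | false = sym (zeroˡ w)
        marked : ∑ t ≈ lam + ℕ→R R (h ∸ 1)
        marked with closing-exists pre κi balanced
        ... | v₀ , free , closes = ∑-one-marked (freeAbove? i s) (closes? i s) lam v₀ free closes
              (λ v fv cv → closing-unique pre (subst (¬_ ∘ Down) (≡.sym κi) λ ()) fv free cv closes)
      byKind cdrise κi = trans (∑-below-above (freeAbove? i s) d)
        (reflexive (cong (antidiagonal d) (ha (subst (¬_ ∘ Down) (≡.sym κi) λ ()))))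
      byKind oddfix κi = begin
        ∑ (λ v → choiceWeight oddfix i s v)  ≈⟨ ∑-fixed i (lam * f (# (freeAbove? i s))) ⟩
        lam * f (# (freeAbove? i s))        ≡⟨ cong (λ h → lam * f h) (ha (subst (¬_ ∘ Down) (≡.sym κi) λ ())) ⟩
        lam * f (heightAbove i)             ∎
      byKind cpeak κi = trans (∑-above-below (freeBelow? i s) b)
        (reflexive (cong (antidiagonal b) (hb (subst Down (≡.sym κi) tt))))
      byKind cdfall κi = trans (∑-above-below (freeBelow? i s) c)
        (reflexive (cong (antidiagonal c) (hb (subst Down (≡.sym κi) tt))))
      byKind evenfix κi = begin
        ∑ (λ v → choiceWeight evenfix i s v)  ≈⟨ ∑-fixed i (lam * e (# (freeAbove? i s))) ⟩
        lam * e (# (freeAbove? i s))        ≡⟨ cong (λ h → lam * e h) (ha (subst (¬_ ∘ Down) (≡.sym κi) λ ())) ⟩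
        lam * e (heightAbove i)             ∎

    module _ {i : Fin N} {s s′ : Fin N → Fin N} (agree : ∀ k → k ≺ i → s k ≡ s′ k) where
      private
        taken-to : ∀ v → Taken i s v → Taken i s′ v
        taken-to v (k , p , q) = k , p , ≡.trans (≡.sym (agree k p)) q
        taken-from : ∀ v → Taken i s′ v → Taken i s v
        taken-from v (k , p , q) = k , p , ≡.trans (agree k p) q
        fA-to : ∀ v → FreeAbove i s v → FreeAbove i s′ v
        fA-to v (p , q) = p , q ∘ taken-from v
        fA-from : ∀ v → FreeAbove i s′ v → FreeAbove i s v
        fA-from v (p , q) = p , q ∘ taken-to v
        fB-to : ∀ v → FreeBelow i s v → FreeBelow i s′ v
        fB-to v (p , q) = p , q ∘ taken-from v
        fB-from : ∀ v → FreeBelow i s′ v → FreeBelow i s v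
        fB-from v (p , q) = p , q ∘ taken-to v

        reach-to : ¬ Down (κ i) → ∀ r {x} → Reach i s r x → Reach i s′ r x
        reach-to ¬d zero    p       = p
        reach-to ¬d (suc r) (p , q) = p , subst (Reach i s′ r) (agree _ (above-≺ ¬d p)) (reach-to ¬d r q)
        reach-from : ¬ Down (κ i) → ∀ r {x} → Reach i s′ r x → Reach i s r x
        reach-from ¬d zero    p       = p
        reach-from ¬d (suc r) (p , q) = p , subst (Reach i s r) (≡.sym (agree _ (above-≺ ¬d p))) (reach-from ¬d r q)

        #A : # (freeAbove? i s) ≡ # (freeAbove? i s′)
        #A = #-cong (freeAbove? i s) (freeAbove? i s′) fA-to fA-from
        belowA : ∀ v → #below (freeAbove? i s) v ≡ #below (freeAbove? i s′) v
        belowA v = #-cong (λ u → (u F.<? v) ×-dec freeAbove? i s u) (λ u → (u F.<? v) ×-dec freeAbove? i s′ u)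
          (λ u (p , q) → p , fA-to u q) (λ u (p , q) → p , fA-from u q)
        aboveA : ∀ v → #above (freeAbove? i s) v ≡ #above (freeAbove? i s′) v
        aboveA v = #-cong (λ u → (v F.<? u) ×-dec freeAbove? i s u) (λ u → (v F.<? u) ×-dec freeAbove? i s′ u)
          (λ u (p , q) → p , fA-to u q) (λ u (p , q) → p , fA-from u q)
        belowB : ∀ v → #below (freeBelow? i s) v ≡ #below (freeBelow? i s′) v
        belowB v = #-cong (λ u → (u F.<? v) ×-dec freeBelow? i s u) (λ u → (u F.<? v) ×-dec freeBelow? i s′ u)
          (λ u (p , q) → p , fB-to u q) (λ u (p , q) → p , fB-from u q)
        aboveB : ∀ v → #above (freeBelow? i s) v ≡ #above (freeBelow? i s′) v
        aboveB v = #-cong (λ u → (v F.<? u) ×-dec freeBelow? i s u) (λ u → (v F.<? u) ×-dec freeBelow? i s′ u)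
          (λ u (p , q) → p , fB-to u q) (λ u (p , q) → p , fB-from u q)

        allowed-to : ∀ k v → Allowed i s k v → Allowed i s′ k v
        allowed-to cval    = fA-to
        allowed-to cdrise  = fA-to
        allowed-to cpeak   = fB-to
        allowed-to cdfall  = fB-to
        allowed-to oddfix  v p = p
        allowed-to evenfix v p = p
        allowed-from : ∀ k v → Allowed i s′ k v → Allowed i s k v
        allowed-from cval    = fA-from
        allowed-from cdrise  = fA-from
        allowed-from cpeak   = fB-from
        allowed-from cdfall  = fB-from
        allowed-from oddfix  v p = p
        allowed-from evenfix v p = p

        localWeight-local : ∀ k → κ i ≡ k → ∀ v → localWeight k i s v ≡ localWeight k i s′ v
        localWeight-local cval κi v = cong₂ (λ t u → (if t then lam else 1#) * a (u ∸ 1))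
          (does-⇔ (mk⇔ (λ (r , p) → r , reach-to ¬d (toℕ r) p) (λ (r , p) → r , reach-from ¬d (toℕ r) p))
            (closes? i s v) (closes? i s′ v)) #A
          where ¬d = subst (¬_ ∘ Down) (≡.sym κi) λ ()
        localWeight-local cdrise  _ v = cong₂ d (belowA v) (aboveA v)
        localWeight-local oddfix  _ v = cong (λ h → lam * f h) #A
        localWeight-local cpeak   _ v = cong₂ b (aboveB v) (belowB v)
        localWeight-local cdfall  _ v = cong₂ c (aboveB v) (belowB v)
        localWeight-local evenfix _ v = cong (λ h → lam * e h) #A

      allowed-local : ∀ v → Allowed i s (κ i) v → Allowed i s′ (κ i) v
      allowed-local = allowed-to (κ i)

      -- `Taken` inspects only earlier positions by definition; `Closes` enters at valleys, where
      -- every point above `i` is earlier.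
      choiceWeight-local : ∀ v → choiceWeight (κ i) i s v ≡ choiceWeight (κ i) i s′ v
      choiceWeight-local v = if-cong {a? = allowed? i s (κ i) v} {b? = allowed? i s′ (κ i) v}
        (does-⇔ (mk⇔ (allowed-to (κ i) v) (allowed-from (κ i) v)) (allowed? i s (κ i) v) (allowed? i s′ (κ i) v))
        (localWeight-local (κ i) ≡.refl v)

    update-agree : ∀ {i k} (σ : Vec (Fin N) N) w → ¬ k ≺ i → ∀ l → l ≺ i → lookup σ l ≡ lookup (σ [ k ]≔ w) l
    update-agree {i} {k} σ w ¬k≺i l l≺i =
      ≡.sym (VP.lookup∘update′ (λ l≡k → ¬k≺i (subst (_≺ i) l≡k l≺i)) σ w)

    factor-update : ∀ {i k} → i ≺ k → ∀ (σ : Vec (Fin N) N) w →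
                    factor i (lookup (σ [ k ]≔ w)) ≡ factor i (lookup σ)
    factor-update {i} {k} i≺k σ w = ≡.trans
      (cong (choiceWeight (κ i) i (lookup (σ [ k ]≔ w))) (VP.lookup∘update′ i≢k σ w))
      (≡.sym (choiceWeight-local (update-agree σ w (≺-asym i k i≺k)) (lookup σ i)))
      where
      i≢k : i ≢ k
      i≢k ≡.refl = ≺-irrefl i i≺k

    ok-update : ∀ {i k} → i ≺ k → ∀ (σ : Vec (Fin N) N) w → Ok (lookup σ) i → Ok (lookup (σ [ k ]≔ w)) i
    ok-update {i} {k} i≺k σ w o = subst (Allowed i (lookup (σ [ k ]≔ w)) (κ i))
      (≡.sym (VP.lookup∘update′ i≢k σ w)) (allowed-local (update-agree σ w (≺-asym i k i≺k)) _ o)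
      where
      i≢k : i ≢ k
      i≢k ≡.refl = ≺-irrefl i i≺k

    factor-choice : ∀ i (σ : Vec (Fin N) N) v → factor i (lookup (σ [ i ]≔ v)) ≡ choiceWeight (κ i) i (lookup σ) v
    factor-choice i σ v = ≡.trans
      (cong (choiceWeight (κ i) i (lookup (σ [ i ]≔ v))) (VP.lookup∘update i σ v))
      (≡.sym (choiceWeight-local (update-agree σ v (≺-irrefl i)) v))

    factor-¬ok : ∀ i s → ¬ Ok s i → factor i s ≡ 0#
    factor-¬ok i s ¬o = cong (λ t → if t then localWeight (κ i) i s (s i) else 0#) (dec-false (ok? s i) ¬o)

    private
      totalAt : Fin N → Carrier
      totalAt i = total (κ i) (heightBelow i) (heightAbove i)

    module _ (balanced : # (above? ∘ κ) ≡ # (down? ∘ κ)) where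

      -- `is` holds the positions still open; `done` says that all others carry admissible values
      -- and precede the open ones, which is what `∑-choiceWeight` needs. The factor of the head
      -- ignores later positions and so leaves the inner sum.
      sumOver-factors : ∀ is → AllPairs _≺_ is → ∀ (σ : Vec (Fin N) N) →
        (∀ k → k ∈ is ⊎ (Ok (lookup σ) k × All (k ≺_) is)) →
        sumOver is (λ σ → prodOver is (λ k → factor k (lookup σ))) σ ≈ prodOver is totalAt
      sumOver-factors []       []            σ done = refl
      sumOver-factors (i ∷ is) (i≺is ∷ sorted) σ done = begin
        ∑ (λ v → sumOver is (λ σ → factor i (lookup σ) * prodOver is (λ k → factor k (lookup σ))) (σ [ i ]≔ v))
          ≈⟨ ∑-cong (λ v → sumOver-factor is (λ σ → factor i (lookup σ)) _
               (All.map (λ i≺k σ w → reflexive (factor-update i≺k σ w)) i≺is) (σ [ i ]≔ v)) ⟩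
        ∑ (λ v → factor i (lookup (σ [ i ]≔ v)) * sumOver is (λ σ → prodOver is (λ k → factor k (lookup σ))) (σ [ i ]≔ v))
          ≈⟨ ∑-cong step ⟩
        ∑ (λ v → choiceWeight (κ i) i (lookup σ) v * prodOver is totalAt)
          ≈⟨ *-distribʳ-sum {N} (prodOver is totalAt) (choiceWeight (κ i) i (lookup σ)) ⟨
        ∑ (λ v → choiceWeight (κ i) i (lookup σ) v) * prodOver is totalAt
          ≈⟨ *-congʳ (∑-choiceWeight balanced i (lookup σ) pre) ⟩
        totalAt i * prodOver is totalAt ∎
        where
        pre : ∀ k → k ≺ i → Ok (lookup σ) k
        pre k k≺i with done k
        ... | inj₂ (o , _)          = o
        ... | inj₁ (here ≡.refl)    = contradiction k≺i (≺-irrefl k)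
        ... | inj₁ (there k∈is)     = contradiction k≺i (≺-asym i k (All.lookup i≺is k∈is))
        step : ∀ v → factor i (lookup (σ [ i ]≔ v)) * sumOver is (λ σ → prodOver is (λ k → factor k (lookup σ))) (σ [ i ]≔ v)
                   ≈ choiceWeight (κ i) i (lookup σ) v * prodOver is totalAt
        -- The induction hypothesis applies only after an admissible choice; after a forbidden one
        -- both sides have a zero factor.
        step v = decide (ok? (lookup (σ [ i ]≔ v)) i)
          where
          decide : Dec (Ok (lookup (σ [ i ]≔ v)) i) → _ ≈ _
          decide (no ¬o) = trans (*-congʳ (reflexive vanish)) (trans (zeroˡ _) (sym (trans
                  (*-congʳ (reflexive (≡.trans (≡.sym (factor-choice i σ v)) vanish))) (zeroˡ _))))
            where vanish = factor-¬ok i (lookup (σ [ i ]≔ v)) ¬o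
          decide (yes o) = *-cong (reflexive (factor-choice i σ v)) (sumOver-factors is sorted (σ [ i ]≔ v) done′)
            where
            done′ : ∀ k → k ∈ is ⊎ (Ok (lookup (σ [ i ]≔ v)) k × All (k ≺_) is)
            done′ k with done k
            ... | inj₁ (here ≡.refl) = inj₂ (o , i≺is)
            ... | inj₁ (there k∈is)  = inj₁ k∈is
            ... | inj₂ (ok , k≺i ∷ k≺is) = inj₂ (ok-update k≺i σ v ok , k≺is)

      ∑ᵛ-factors : ∑ᵛ (λ σ → ∏ (λ i → factor i (lookup σ))) ≈ ∏ totalAt
      ∑ᵛ-factors = begin
        ∑ᵛ (λ σ → ∏ (λ i → factor i (lookup σ)))
          ≈⟨ ∑ᵛ-cong {N} {N} (λ σ → trans (sym (prodOver-allFin (λ i → factor i (lookup σ)))) (prodOver-↭ (λ i → factor i (lookup σ)) (↭-sym perm))) ⟩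
        ∑ᵛ (λ σ → prodOver (choiceOrder κ) (λ i → factor i (lookup σ)))
          ≈⟨ sumOver-allFin _ σ₀ ⟨
        sumOver (allFin N) (λ σ → prodOver (choiceOrder κ) (λ i → factor i (lookup σ))) σ₀
          ≈⟨ sumOver-↭ _ (↭-sym perm) σ₀ ⟩
        sumOver (choiceOrder κ) (λ σ → prodOver (choiceOrder κ) (λ i → factor i (lookup σ))) σ₀
          ≈⟨ sumOver-factors (choiceOrder κ) (choiceOrder-sorted κ) σ₀
               (λ k → inj₁ (PermP.∈-resp-↭ (↭-sym perm) (MemP.∈-allFin k))) ⟩
        prodOver (choiceOrder κ) totalAt ≈⟨ prodOver-↭ totalAt perm ⟩
        prodOver (allFin N) totalAt      ≈⟨ prodOver-allFin totalAt ⟩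
        ∏ totalAt ∎
        where
        perm = choiceOrder-↭ κ
        -- Any vector would do, since every entry is overwritten.
        σ₀ = V.allFin N

    module _ {s : Fin N → Fin N} (ok : ∀ i → Ok s i) where

      ok⇒injective : Inj s
      ok⇒injective = ok-injective (ok _) (ok _)

      -- The above-values are exactly the images of the deficiencies.
      ok⇒balanced : # (above? ∘ κ) ≡ # (down? ∘ κ)
      ok⇒balanced = ≡.trans (#-injective ok⇒injective (above? ∘ κ))
        (#-cong (above? ∘ κ ∘ s) (down? ∘ κ) (λ k → ok-above (ok k)) (λ k dk → proj₂ (proj₁ (allowed-down _ dk (ok k)))))

    ∏-factor-¬ok : ∀ s → ¬ (∀ i → Ok s i) → ∏ (λ i → factor i s) ≈ 0#
    ∏-factor-¬ok s ¬ok with FP.¬∀⟶∃¬ N (Ok s) (ok? s) ¬ok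
    ... | i , ¬o = ∏-zero (λ i → factor i s) i (reflexive (factor-¬ok i s ¬o))

    ∑ᵛ-factors-unbalanced : # (above? ∘ κ) ≢ # (down? ∘ κ) → ∑ᵛ {N} {N} (λ σ → ∏ (λ i → factor i (lookup σ))) ≈ 0#
    ∑ᵛ-factors-unbalanced ¬bal = ∑ᵛ-zero {N} {N} (λ σ → ∏-factor-¬ok (lookup σ) (λ ok → ¬bal (ok⇒balanced ok)))

-- Coefficients of J-fractions

double : ℕ → ℕ
double zero    = zero
double (suc h) = suc (suc (double h))

module JFractions {c ℓ : Level} (R : CommutativeRing c ℓ) where
  open CommutativeRing R hiding (zero)
  open import Relation.Binary.Reasoning.Setoid setoid
  open import Algebra.Properties.CommutativeSemigroup *-commutativeSemigroup using (x∙yz≈y∙xz)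
  open import Algebra.Properties.CommutativeSemigroup +-commutativeSemigroup using (interchange)

  infixl 7 _⋆_
  -- The Cauchy product of power series.
  _⋆_ : (ℕ → Carrier) → (ℕ → Carrier) → ℕ → Carrier
  (p ⋆ q) zero    = p 0 * q 0
  (p ⋆ q) (suc n) = p 0 * q (suc n) + (p ∘ suc ⋆ q) n

  ⋆-cong : ∀ n {p p′ q q′} → (∀ j → j ℕ.≤ n → p j ≈ p′ j) → (∀ j → j ℕ.≤ n → q j ≈ q′ j) → (p ⋆ q) n ≈ (p′ ⋆ q′) n
  ⋆-cong zero    hp hq = *-cong (hp 0 z≤n) (hq 0 z≤n)
  ⋆-cong (suc n) hp hq = +-cong (*-cong (hp 0 z≤n) (hq (suc n) ℕP.≤-refl))
    (⋆-cong n (λ j j≤n → hp (suc j) (s≤s j≤n)) (λ j j≤n → hq j (ℕP.m≤n⇒m≤1+n j≤n)))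

  ⋆-linearˡ : ∀ x p q u n → ((λ j → x * p j + q j) ⋆ u) n ≈ x * (p ⋆ u) n + (q ⋆ u) n
  ⋆-linearˡ x p q u zero    = trans (distribʳ _ _ _) (+-congʳ (*-assoc _ _ _))
  ⋆-linearˡ x p q u (suc n) = begin
    (x * p 0 + q 0) * u (suc n) + ((λ j → x * p (suc j) + q (suc j)) ⋆ u) n
      ≈⟨ +-cong (trans (distribʳ _ _ _) (+-congʳ (*-assoc _ _ _))) (⋆-linearˡ x (p ∘ suc) (q ∘ suc) u n) ⟩
    (x * (p 0 * u (suc n)) + q 0 * u (suc n)) + (x * (p ∘ suc ⋆ u) n + (q ∘ suc ⋆ u) n)
      ≈⟨ interchange _ _ _ _ ⟩
    (x * (p 0 * u (suc n)) + x * (p ∘ suc ⋆ u) n) + (q 0 * u (suc n) + (q ∘ suc ⋆ u) n)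
      ≈⟨ +-congʳ (distribˡ _ _ _) ⟨
    x * (p ⋆ u) (suc n) + (q ⋆ u) (suc n) ∎

  ⋆-scaleʳ : ∀ x p u n → (p ⋆ (λ j → x * u j)) n ≈ x * (p ⋆ u) n
  ⋆-scaleʳ x p u zero    = x∙yz≈y∙xz _ _ _
  ⋆-scaleʳ x p u (suc n) = trans (+-cong (x∙yz≈y∙xz _ _ _) (⋆-scaleʳ x (p ∘ suc) u n)) (sym (distribˡ _ _ _))

  ⋆-assoc : ∀ p q u n → (p ⋆ q ⋆ u) n ≈ (p ⋆ (q ⋆ u)) n
  ⋆-assoc p q u zero    = *-assoc _ _ _
  ⋆-assoc p q u (suc n) = begin
    p 0 * q 0 * u (suc n) + ((λ j → p 0 * q (suc j) + (p ∘ suc ⋆ q) j) ⋆ u) n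
      ≈⟨ +-cong (*-assoc _ _ _) (⋆-linearˡ (p 0) (q ∘ suc) (p ∘ suc ⋆ q) u n) ⟩
    p 0 * (q 0 * u (suc n)) + (p 0 * (q ∘ suc ⋆ u) n + (p ∘ suc ⋆ q ⋆ u) n)
      ≈⟨ +-assoc _ _ _ ⟨
    p 0 * (q 0 * u (suc n)) + p 0 * (q ∘ suc ⋆ u) n + (p ∘ suc ⋆ q ⋆ u) n
      ≈⟨ +-cong (sym (distribˡ _ _ _)) (⋆-assoc (p ∘ suc) q u n) ⟩
    (p ⋆ (q ⋆ u)) (suc n) ∎

  zero-⋆ : ∀ p u → (∀ j → p j ≈ 0#) → ∀ n → (p ⋆ u) n ≈ 0#
  zero-⋆ p u h zero    = trans (*-congʳ (h 0)) (zeroˡ _)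
  zero-⋆ p u h (suc n) = trans (+-cong (trans (*-congʳ (h 0)) (zeroˡ _)) (zero-⋆ (p ∘ suc) u (h ∘ suc) n)) (+-identityˡ _)

  shift : (ℕ → Carrier) → ℕ → Carrier
  shift u zero    = 0#
  shift u (suc n) = u n

  ⋆-shift : ∀ p u n → (p ⋆ shift u) n ≈ shift (p ⋆ u) n
  ⋆-shift p u zero          = zeroʳ _
  ⋆-shift p u (suc zero)    = trans (+-congˡ (zeroʳ _)) (+-identityʳ _)
  ⋆-shift p u (suc (suc n)) = +-congˡ (⋆-shift (p ∘ suc) u (suc n))

  invS-suc : ∀ h n → invS R h (suc n) ≈ (h ⋆ invS R h) n
  invS-suc h = dot h
    where
    dot : ∀ g n → sumR R (V.toList (V.zipWith _*_ (V.tabulate (λ j → g (toℕ j))) (invVec R h n))) ≈ (g ⋆ invS R h) n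
    dot g zero    = +-identityʳ _
    dot g (suc n) = +-congˡ (dot (g ∘ suc) n)

  invS-cong : ∀ n {h h′} → (∀ j → j < n → h j ≈ h′ j) → invS R h n ≈ invS R h′ n
  invS-cong n {h} {h′} eq = prefix n eq n ℕP.≤-refl
    where
    prefix : ∀ n → (∀ j → j < n → h j ≈ h′ j) → ∀ k → k ℕ.≤ n → invS R h k ≈ invS R h′ k
    prefix n       eq zero    _         = refl
    prefix (suc n) eq (suc k) (s≤s k≤n) = begin
      invS R h (suc k)       ≈⟨ invS-suc h k ⟩
      (h ⋆ invS R h) k       ≈⟨ ⋆-cong k (λ j j≤k → eq j (s≤s (ℕP.≤-trans j≤k k≤n)))
                                  (λ j j≤k → prefix n (λ i i<n → eq i (ℕP.m<n⇒m<1+n i<n)) j (ℕP.≤-trans j≤k k≤n)) ⟩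
      (h′ ⋆ invS R h′) k     ≈⟨ invS-suc h′ k ⟨
      invS R h′ (suc k)      ∎

  module _ (α δ : ℕ → Carrier) where

    -- Every level of the fraction carries a factor t, so depth `m` settles all coefficients below
    -- the m-th power.
    Jfrac-stable : ∀ {m m′} k n → n < m → n < m′ → Jfrac R α δ k m n ≈ Jfrac R α δ k m′ n
    Jfrac-stable {suc m} {suc m′} k n (s≤s n≤m) (s≤s n≤m′) = invS-cong n λ j j<n →
      +-congˡ (*-congˡ (Jfrac-stable (suc k) j (ℕP.<-≤-trans j<n n≤m) (ℕP.<-≤-trans j<n n≤m′)))

    -- The coefficient of tⁿ no longer depends on the truncation depth once that exceeds n.
    tail : ℕ → ℕ → Carrier
    tail k n = Jfrac R α δ k (suc n) n

    -- With T and T′ the series of `tail k` and `tail (suc k)`, this is T = 1 + t(δT + αT′T) read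
    -- off at one coefficient.
    tail-suc : ∀ k n → tail k (suc n) ≈ δ k * tail k n + α k * (tail (suc k) ⋆ tail k) n
    tail-suc k n = begin
      tail k (suc n)                              ≈⟨ invS-suc _ n ⟩
      (_ ⋆ _) n                                   ≈⟨ ⋆-cong n (λ j j≤n → trans (+-comm _ _) (+-congʳ (*-congˡ (Jfrac-stable (suc k) j (s≤s j≤n) ℕP.≤-refl))))
                                                       (λ j j≤n → Jfrac-stable k j (ℕP.m≤n⇒m≤1+n (s≤s j≤n)) ℕP.≤-refl) ⟩
      ((λ j → α k * tail (suc k) j + constant j) ⋆ tail k) n ≈⟨ ⋆-linearˡ (α k) (tail (suc k)) constant (tail k) n ⟩
      α k * (tail (suc k) ⋆ tail k) n + (constant ⋆ tail k) n ≈⟨ +-congˡ (constant-⋆ n) ⟩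
      α k * (tail (suc k) ⋆ tail k) n + δ k * tail k n ≈⟨ +-comm _ _ ⟩
      δ k * tail k n + α k * (tail (suc k) ⋆ tail k) n ∎
      where
      constant : ℕ → Carrier
      constant j = if eqB j 0 then δ k else 0#
      constant-⋆ : ∀ n → (constant ⋆ tail k) n ≈ δ k * tail k n
      constant-⋆ zero    = refl
      constant-⋆ (suc n) = trans (+-congˡ (zero-⋆ (constant ∘ suc) (tail k) (λ _ → refl) n)) (+-identityʳ _)

    tail-⋆-zero : ∀ k u → (tail k ⋆ u) 0 ≈ u 0
    tail-⋆-zero k u = *-identityˡ _

    -- First-return decomposition: either `u` starts at once, or one excursion of weight `α k` comes
    -- first.
    tail-⋆-suc : ∀ k u n → δ k ≈ 0# → (tail k ⋆ u) (suc n) ≈ u (suc n) + α k * (tail (suc k) ⋆ (tail k ⋆ u)) n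
    tail-⋆-suc k u n δ≈0 = begin
      1# * u (suc n) + (tail k ∘ suc ⋆ u) n ≈⟨ +-cong (*-identityˡ _) (⋆-cong n (λ j _ → step j) (λ _ _ → refl)) ⟩
      u (suc n) + ((λ j → α k * (tail (suc k) ⋆ tail k) j + 0#) ⋆ u) n
        ≈⟨ +-congˡ (⋆-linearˡ (α k) (tail (suc k) ⋆ tail k) (λ _ → 0#) u n) ⟩
      u (suc n) + (α k * (tail (suc k) ⋆ tail k ⋆ u) n + ((λ _ → 0#) ⋆ u) n)
        ≈⟨ +-congˡ (trans (+-congˡ (zero-⋆ (λ _ → 0#) u (λ _ → refl) n)) (+-identityʳ _)) ⟩
      u (suc n) + α k * (tail (suc k) ⋆ tail k ⋆ u) n
        ≈⟨ +-congˡ (*-congˡ (⋆-assoc (tail (suc k)) (tail k) u n)) ⟩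
      u (suc n) + α k * (tail (suc k) ⋆ (tail k ⋆ u)) n ∎
      where
      step : ∀ j → tail k (suc j) ≈ α k * (tail (suc k) ⋆ tail k) j + 0#
      step j = trans (tail-suc k j) (trans (+-congʳ (trans (*-congʳ δ≈0) (zeroˡ _))) (+-comm _ _))

    -- In terms of levels, `A h` leads from 2h to 2h + 1 and `B (suc h)` back, `E (suc h)` from 2h +
    -- 1 to 2h + 2 and `F (suc h)` back. `F 0` and `E 0` lead from 0 to -1 and back. One power of t
    -- stands for two steps.
    module Contraction (A B E F : ℕ → Carrier)
      (α-odd : ∀ h → α (suc (double h)) ≈ A h * B (suc h))
      (α-even : ∀ h → α (double (suc h)) ≈ E (suc h) * F (suc h))
      (δ-one : δ 1 ≈ F 0 * E 0) (δ-rest : ∀ k → δ (suc (suc k)) ≈ 0#) where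

      -- First-passage products: even h enumerates the paths from level 2h to level 0, odd h those from level 2h + 1.
      even odd : ℕ → ℕ → Carrier
      even zero    = tail 1
      even (suc h) = shift (λ n → F (suc h) * (tail (suc (double (suc h))) ⋆ odd h) n)
      odd h n      = B (suc h) * (tail (double (suc h)) ⋆ even h) n

      -- A walk from level 2h + 1 begins with a step down or a step up. On the series side this
      -- unfolds `tail` once and splits its α into `E` and `F`.
      odd-step : ∀ h n → odd h n ≈ B (suc h) * even h n + E (suc h) * even (suc h) n
      odd-step h zero    = trans (*-congˡ (tail-⋆-zero (double (suc h)) (even h)))
        (sym (trans (+-congˡ (zeroʳ _)) (+-identityʳ _)))
      odd-step h (suc n) = begin
        B (suc h) * (g ⋆ even h) (suc n)
          ≈⟨ *-congˡ (tail-⋆-suc k (even h) n (δ-rest _)) ⟩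
        B (suc h) * (even h (suc n) + α k * (g′ ⋆ (g ⋆ even h)) n)
          ≈⟨ distribˡ _ _ _ ⟩
        B (suc h) * even h (suc n) + B (suc h) * (α k * (g′ ⋆ (g ⋆ even h)) n)
          ≈⟨ +-congˡ (x∙yz≈y∙xz _ _ _) ⟩
        B (suc h) * even h (suc n) + α k * (B (suc h) * (g′ ⋆ (g ⋆ even h)) n)
          ≈⟨ +-congˡ (*-cong (α-even h) (sym (⋆-scaleʳ (B (suc h)) g′ (g ⋆ even h) n))) ⟩
        B (suc h) * even h (suc n) + E (suc h) * F (suc h) * (g′ ⋆ odd h) n
          ≈⟨ +-congˡ (*-assoc _ _ _) ⟩
        B (suc h) * even h (suc n) + E (suc h) * even (suc h) (suc n) ∎
        where
        k = double (suc h)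
        g = tail k
        g′ = tail (suc k)

      even-step : ∀ h n → even (suc h) (suc n) ≈ A (suc h) * odd (suc h) n + F (suc h) * odd h n
      even-step h n = begin
        F (suc h) * G n                                                     ≈⟨ *-congˡ (expand n) ⟩
        F (suc h) * (odd h n + α k * shift (g′ ⋆ G) n)                      ≈⟨ distribˡ _ _ _ ⟩
        F (suc h) * odd h n + F (suc h) * (α k * shift (g′ ⋆ G) n)          ≈⟨ +-congˡ (x∙yz≈y∙xz _ _ _) ⟩
        F (suc h) * odd h n + α k * (F (suc h) * shift (g′ ⋆ G) n)          ≈⟨ +-congˡ (*-cong (α-odd (suc h)) (collect n)) ⟩
        F (suc h) * odd h n + A (suc h) * B (suc (suc h)) * (g′ ⋆ even (suc h)) n ≈⟨ +-congˡ (*-assoc _ _ _) ⟩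
        F (suc h) * odd h n + A (suc h) * odd (suc h) n                     ≈⟨ +-comm _ _ ⟩
        A (suc h) * odd (suc h) n + F (suc h) * odd h n                     ∎
        where
        k = suc (double (suc h))
        G = tail k ⋆ odd h
        g′ = tail (suc k)
        -- One unfolding of `tail k`, with the factor t written as `shift` so that both degrees have
        -- one formula.
        expand : ∀ n → G n ≈ odd h n + α k * shift (g′ ⋆ G) n
        expand zero    = trans (tail-⋆-zero k (odd h)) (sym (trans (+-congˡ (zeroʳ _)) (+-identityʳ _)))
        expand (suc n) = tail-⋆-suc k (odd h) n (δ-rest _)
        collect : ∀ n → F (suc h) * shift (g′ ⋆ G) n ≈ (g′ ⋆ even (suc h)) n
        collect n = sym (trans (⋆-shift g′ (λ j → F (suc h) * G j) n) (scale n))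
          where
          scale : ∀ n → shift (g′ ⋆ (λ j → F (suc h) * G j)) n ≈ F (suc h) * shift (g′ ⋆ G) n
          scale zero    = sym (zeroʳ _)
          scale (suc n) = ⋆-scaleʳ (F (suc h)) g′ G n

      even-zero-step : ∀ n → even 0 (suc n) ≈ A 0 * odd 0 n + F 0 * (E 0 * even 0 n)
      even-zero-step n = begin
        tail 1 (suc n)                                        ≈⟨ tail-suc 1 n ⟩
        δ 1 * tail 1 n + α 1 * (tail 2 ⋆ tail 1) n            ≈⟨ +-cong (*-congʳ δ-one) (*-congʳ (α-odd 0)) ⟩
        F 0 * E 0 * tail 1 n + A 0 * B 1 * (tail 2 ⋆ tail 1) n ≈⟨ +-cong (*-assoc _ _ _) (*-assoc _ _ _) ⟩
        F 0 * (E 0 * tail 1 n) + A 0 * odd 0 n                ≈⟨ +-comm _ _ ⟩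
        A 0 * odd 0 n + F 0 * (E 0 * tail 1 n)                ∎

      -- The hypotheses determine `W`, the first-passage products satisfy them too, and `even 0` is
      -- the fraction itself.
      walks≈Jfrac : (W : ℕ → ℕ → Carrier) → W 0 0 ≈ 1# → (∀ h → W (suc h) 0 ≈ 0#) →
        (∀ n → W 0 (suc n) ≈ A 0 * (B 1 * W 0 n + E 1 * W 1 n) + F 0 * (E 0 * W 0 n)) →
        (∀ h n → W (suc h) (suc n) ≈ A (suc h) * (B (suc (suc h)) * W (suc h) n + E (suc (suc h)) * W (suc (suc h)) n)
                                   + F (suc h) * (B (suc h) * W h n + E (suc h) * W (suc h) n)) →
        ∀ {m} n → n < m → W 0 n ≈ Jfrac R α δ 1 m n
      walks≈Jfrac W start₀ start₊ step₀ step₊ n n<m = trans (agree n 0) (Jfrac-stable 1 n ℕP.≤-refl n<m)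
        where
        agree : ∀ n h → W h n ≈ even h n
        agree-odd : ∀ n h → B (suc h) * W h n + E (suc h) * W (suc h) n ≈ odd h n
        agree zero    zero    = start₀
        agree zero    (suc h) = start₊ h
        agree (suc n) zero    = trans (step₀ n) (trans
          (+-cong (*-congˡ (agree-odd n 0)) (*-congˡ (*-congˡ (agree n 0)))) (sym (even-zero-step n)))
        agree (suc n) (suc h) = trans (step₊ h n) (trans
          (+-cong (*-congˡ (agree-odd n (suc h))) (*-congˡ (agree-odd n h))) (sym (even-step h n)))
        agree-odd n h = trans (+-cong (*-congˡ (agree n h)) (*-congˡ (agree n (suc h)))) (sym (odd-step h n))

-- Lattice paths

-- `true` marks an odd position in the 1-based count. There σ(i) ≥ i leaves exactly three kinds, and
-- at an even position σ(i) ≤ i leaves the other three.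
kind : Bool → Fin 3 → Kind
kind true  0F = cval
kind true  1F = cdrise
kind true  2F = oddfix
kind false 0F = cpeak
kind false 1F = cdfall
kind false 2F = evenfix

kinds : ∀ {N} → Bool → Vec (Fin 3) N → Fin N → Kind
kinds p (x ∷ τ) zero    = kind p x
kinds p (x ∷ τ) (suc i) = kinds (not p) τ i

next : Kind → ℕ → ℕ
next cval  h = suc h
next cpeak h = pred h
next _     h = h

-- The first equation of `step` follows the height as a count of deficiency arcs from the left,
-- after `D` deficiencies; the other two follow it as a count of excedance arcs from the right. Both
-- fail for a peak at height zero, where `pred` stays at 0, but such a peak has weight zero.
data Step (k : Kind) (h : ℕ) : Set where
  blocked : k ≡ cpeak → h ≡ 0 → Step k h
  step    : (∀ D → h ℕ.+ D ℕ.+ ⟦ above? k ⟧ ≡ next k h ℕ.+ (D ℕ.+ ⟦ down? k ⟧)) →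
            (∀ u w → h ℕ.+ (⟦ up? k ⟧ ℕ.+ u) ≡ ⟦ below? k ⟧ ℕ.+ w → next k h ℕ.+ u ≡ w) →
            (∀ u w → next k h ℕ.+ u ≡ w → h ℕ.+ (⟦ up? k ⟧ ℕ.+ u) ≡ ⟦ below? k ⟧ ℕ.+ w) → Step k h

step? : ∀ k h → Step k h
step? cval h = step (λ D → solve 2 (λ h D → h :+ D :+ con 1 := con 1 :+ h :+ (D :+ con 0)) ≡.refl h D)
    (λ u w → ≡.trans (≡.sym (ℕP.+-suc h u))) (λ u w → ≡.trans (ℕP.+-suc h u))
  where open +-*-Solver
step? cdrise h = step (λ D → solve 2 (λ h D → h :+ D :+ con 0 := h :+ (D :+ con 0)) ≡.refl h D)
    (λ u w eq → ℕP.suc-injective (≡.trans (≡.sym (ℕP.+-suc h u)) eq)) (λ u w eq → ≡.trans (ℕP.+-suc h u) (cong suc eq))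
  where open +-*-Solver
step? oddfix h = step (λ D → solve 2 (λ h D → h :+ D :+ con 0 := h :+ (D :+ con 0)) ≡.refl h D) (λ u w eq → eq) (λ u w eq → eq)
  where open +-*-Solver
step? evenfix h = step (λ D → solve 2 (λ h D → h :+ D :+ con 0 := h :+ (D :+ con 0)) ≡.refl h D) (λ u w eq → eq) (λ u w eq → eq)
  where open +-*-Solver
step? cdfall h = step (λ D → solve 2 (λ h D → h :+ D :+ con 1 := h :+ (D :+ con 1)) ≡.refl h D) (λ u w eq → eq) (λ u w eq → eq)
  where open +-*-Solver
step? cpeak zero = blocked ≡.refl ≡.refl
step? cpeak (suc h) = step (λ D → solve 2 (λ h D → con 1 :+ h :+ D :+ con 0 := h :+ (D :+ con 1)) ≡.refl h D)
    (λ u w → ℕP.suc-injective) (λ u w → cong suc)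
  where open +-*-Solver

-- A non-fixed point is one of `up`, `down` and one of `above`, `below`. So equality of the `above`
-- and `down` counts amounts to equality of the `up` and `below` counts, the condition for a path
-- from 0 to end at 0.
balance : ∀ {N} (κ : Fin N → Kind) → # (up? ∘ κ) ℕ.+ # (down? ∘ κ) ≡ # (above? ∘ κ) ℕ.+ # (below? ∘ κ)
balance κ = ≡.trans (≡.sym (∑-distrib-+ (λ i → ⟦ up? (κ i) ⟧) (λ i → ⟦ down? (κ i) ⟧)))
  (≡.trans (sum-cong-≗ (λ i → pointwise (κ i))) (∑-distrib-+ (λ i → ⟦ above? (κ i) ⟧) (λ i → ⟦ below? (κ i) ⟧)))
  where
  pointwise : ∀ k → ⟦ up? k ⟧ ℕ.+ ⟦ down? k ⟧ ≡ ⟦ above? k ⟧ ℕ.+ ⟦ below? k ⟧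
  pointwise cval    = ≡.refl
  pointwise cdrise  = ≡.refl
  pointwise oddfix  = ≡.refl
  pointwise cpeak   = ≡.refl
  pointwise cdfall  = ≡.refl
  pointwise evenfix = ≡.refl

module Paths {ℓ₁ ℓ₂ : Level} (R : CommutativeRing ℓ₁ ℓ₂)
  (lam : CommutativeRing.Carrier R) (a : ℕ → CommutativeRing.Carrier R)
  (b c d : ℕ → ℕ → CommutativeRing.Carrier R) (e f : ℕ → CommutativeRing.Carrier R) where
  open CommutativeRing R hiding (zero)
  open RingSums R
  open VecSums R
  open Weights R lam a b c d e f
  open import Relation.Binary.Reasoning.Setoid setoid

  stepWeight : Kind → ℕ → Carrier
  stepWeight cval    h = (lam + ℕ→R R h) * a h
  stepWeight cdrise  h = antidiagonal d h
  stepWeight oddfix  h = lam * f h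
  stepWeight cpeak   h = antidiagonal b h
  stepWeight cdfall  h = antidiagonal c h
  stepWeight evenfix h = lam * e h

  pathWeight : ∀ {N} → ℕ → (Fin N → Kind) → Carrier
  pathWeight {zero}  zero    κ = 1#
  pathWeight {zero}  (suc _) κ = 0#
  pathWeight {suc N} h       κ = stepWeight (κ zero) h * pathWeight (next (κ zero) h) (κ ∘ suc)

  -- Off blocked peaks `w ∸ u` is the height after the step: `suc h` at a valley, `h` at a cyclic
  -- rise or a fixed point.
  total≡stepWeight : ∀ k h u w → h ℕ.+ (⟦ up? k ⟧ ℕ.+ u) ≡ ⟦ below? k ⟧ ℕ.+ w → total k h (w ∸ u) ≡ stepWeight k h
  total≡stepWeight k h u w eq with step? k h
  total≡stepWeight k h u w eq | blocked ≡.refl ≡.refl = ≡.refl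
  total≡stepWeight k h u w eq | step _ balanced _ with balanced u w eq
  total≡stepWeight cval    h u w eq | step _ _ _ | ≡.refl = cong (λ t → (lam + ℕ→R R (t ∸ 1)) * a (t ∸ 1)) (ℕP.m+n∸n≡m (suc h) u)
  total≡stepWeight cdrise  h u w eq | step _ _ _ | ≡.refl = cong (antidiagonal d) (ℕP.m+n∸n≡m h u)
  total≡stepWeight oddfix  h u w eq | step _ _ _ | ≡.refl = cong (λ t → lam * f t) (ℕP.m+n∸n≡m h u)
  total≡stepWeight evenfix h u w eq | step _ _ _ | ≡.refl = cong (λ t → lam * e t) (ℕP.m+n∸n≡m h u)
  total≡stepWeight cpeak   h u w eq | step _ _ _ | ≡.refl = ≡.refl
  total≡stepWeight cdfall  h u w eq | step _ _ _ | ≡.refl = ≡.refl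

  stepWeight-blocked : ∀ {k h} → k ≡ cpeak → h ≡ 0 → stepWeight k h ≈ 0#
  stepWeight-blocked ≡.refl ≡.refl = refl

  -- Generalised to a path that stands at height `h` after `D` deficiencies: `h + D` above-values
  -- then lie to the left, `D` of them taken. The hypothesis says that the path will end at 0.
  ∏-total : ∀ {N} (κ : Fin N → Kind) h D → h ℕ.+ # (up? ∘ κ) ≡ # (below? ∘ κ) →
    ∏ (λ i → total (κ i) (h ℕ.+ D ℕ.+ #below (above? ∘ κ) i ∸ (D ℕ.+ #below (down? ∘ κ) i)) (Order.heightAbove κ i))
      ≈ pathWeight h κ
  ∏-total {zero}  κ zero D eq = refl
  ∏-total {suc N} κ h D eq = begin
    headTotal * ∏ (λ i → total (κ (suc i)) (h ℕ.+ D ℕ.+ (⟦ above? k ⟧ ℕ.+ x i) ∸ (D ℕ.+ (⟦ down? k ⟧ ℕ.+ y i))) (ha i))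
      ≈⟨ *-cong (reflexive head≡) (∏-cong {N} (λ i → reflexive (cong₂ (λ s t → total (κ (suc i)) (s ∸ t) (ha i))
           (≡.sym (ℕP.+-assoc (h ℕ.+ D) ⟦ above? k ⟧ (x i))) (≡.sym (ℕP.+-assoc D ⟦ down? k ⟧ (y i)))))) ⟩
    stepWeight k h * ∏ (λ i → total (κ (suc i)) (h ℕ.+ D ℕ.+ ⟦ above? k ⟧ ℕ.+ x i ∸ (D ℕ.+ ⟦ down? k ⟧ ℕ.+ y i)) (ha i))
      ≈⟨ rest (step? k h) ⟩
    stepWeight k h * pathWeight (next k h) (κ ∘ suc) ∎
    where
    k = κ zero
    x y ha : Fin N → ℕ
    x = #below (above? ∘ κ ∘ suc)
    y = #below (down? ∘ κ ∘ suc)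
    ha = Order.heightAbove (κ ∘ suc)
    headTotal = total k (h ℕ.+ D ℕ.+ #below (above? ∘ κ) zero ∸ (D ℕ.+ #below (down? ∘ κ) zero)) (Order.heightAbove κ zero)
    hb≡h : h ℕ.+ D ℕ.+ #below (above? ∘ κ) zero ∸ (D ℕ.+ #below (down? ∘ κ) zero) ≡ h
    hb≡h = ≡.trans (cong₂ (λ s t → h ℕ.+ D ℕ.+ s ∸ (D ℕ.+ t)) (#below-zero (above? ∘ κ)) (#below-zero (down? ∘ κ)))
      (≡.trans (cong₂ _∸_ (ℕP.+-identityʳ (h ℕ.+ D)) (ℕP.+-identityʳ D)) (ℕP.m+n∸n≡m h D))
    head≡ : headTotal ≡ stepWeight k h
    head≡ = ≡.trans (cong (λ t → total k t (Order.heightAbove κ zero)) hb≡h)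
      (total≡stepWeight k h (# (up? ∘ κ ∘ suc)) (# (below? ∘ κ ∘ suc)) eq)
    rest : Step k h →
      stepWeight k h * ∏ (λ i → total (κ (suc i)) (h ℕ.+ D ℕ.+ ⟦ above? k ⟧ ℕ.+ x i ∸ (D ℕ.+ ⟦ down? k ⟧ ℕ.+ y i)) (ha i))
        ≈ stepWeight k h * pathWeight (next k h) (κ ∘ suc)
    -- The zero weight of the blocked peak makes it unnecessary to compare the remaining factors.
    rest (blocked p q) = trans (*-congʳ (stepWeight-blocked p q)) (trans (zeroˡ _)
      (sym (trans (*-congʳ (stepWeight-blocked p q)) (zeroˡ _))))
    rest (step A-eq to _) = *-congˡ (trans
      (∏-cong {N} (λ i → reflexive (cong (λ t → total (κ (suc i)) (t ℕ.+ x i ∸ (D ℕ.+ ⟦ down? k ⟧ ℕ.+ y i)) (ha i)) (A-eq D))))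
      (∏-total (κ ∘ suc) (next k h) (D ℕ.+ ⟦ down? k ⟧) (to _ _ eq)))

  -- `up` minus `below` equals valleys minus peaks, so the path misses 0 at its end unless a blocked
  -- peak has already made the weight zero.
  pathWeight-unbalanced : ∀ {N} (κ : Fin N → Kind) h → h ℕ.+ # (up? ∘ κ) ≢ # (below? ∘ κ) → pathWeight h κ ≈ 0#
  pathWeight-unbalanced {zero}  κ zero    ne = contradiction ≡.refl ne
  pathWeight-unbalanced {zero}  κ (suc h) ne = refl
  pathWeight-unbalanced {suc N} κ h ne with step? (κ zero) h
  ... | blocked p q     = trans (*-congʳ (stepWeight-blocked p q)) (zeroˡ _)
  ... | step _ _ from   = trans (*-congˡ (pathWeight-unbalanced (κ ∘ suc) (next (κ zero) h) (ne ∘ from _ _))) (zeroʳ _)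

  ∑ᵛ-∏-factor : ∀ {N} (κ : Fin N → Kind) → ∑ᵛ {N} {N} (λ σ → ∏ (λ i → Local.factor κ i (lookup σ))) ≈ pathWeight 0 κ
  ∑ᵛ-∏-factor {N} κ with # (above? ∘ κ) ℕ.≟ # (down? ∘ κ)
  ... | yes bal = trans (Local.∑ᵛ-factors κ bal) (∏-total κ 0 0
        (ℕP.+-cancelʳ-≡ (# (down? ∘ κ)) _ _ (≡.trans (balance κ) (≡.trans (ℕP.+-comm (# (above? ∘ κ)) _) (cong (# (below? ∘ κ) ℕ.+_) bal)))))
  ... | no ¬bal = trans (Local.∑ᵛ-factors-unbalanced κ ¬bal) (sym (pathWeight-unbalanced κ 0
        (λ eq → ¬bal (ℕP.+-cancelʳ-≡ (# (below? ∘ κ)) _ _ (≡.trans (≡.sym (balance κ)) (≡.trans (cong (ℕ._+ # (down? ∘ κ)) eq) (ℕP.+-comm (# (below? ∘ κ)) _)))))))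

  walks : Bool → ℕ → ℕ → Carrier
  walks p h N = ∑ᵛ {N} {3} (λ τ → pathWeight h (kinds p τ))

  A B E F : ℕ → Carrier
  A h = stepWeight cval h
  B h = stepWeight cpeak h
  E h = stepWeight evenfix h + stepWeight cdfall h
  F h = stepWeight oddfix h + stepWeight cdrise h

  private
    walks-suc : ∀ p h N → walks p h (suc N) ≈
      stepWeight (kind p 0F) h * walks (not p) (next (kind p 0F) h) N
      + (stepWeight (kind p 1F) h * walks (not p) (next (kind p 1F) h) N
      + (stepWeight (kind p 2F) h * walks (not p) (next (kind p 2F) h) N + 0#))
    walks-suc p h N = +-cong (pull 0F) (+-cong (pull 1F) (+-congʳ (pull 2F)))
      where
      pull : ∀ x → ∑ᵛ {N} {3} (λ τ → stepWeight (kind p x) h * pathWeight (next (kind p x) h) (kinds (not p) τ))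
                 ≈ stepWeight (kind p x) h * walks (not p) (next (kind p x) h) N
      pull x = ∑ᵛ-distribˡ {N} {3} (stepWeight (kind p x) h) (λ τ → pathWeight (next (kind p x) h) (kinds (not p) τ))

    gather : ∀ y z w → y * w + (z * w + 0#) ≈ (z + y) * w
    gather y z w = trans (+-congˡ (+-identityʳ _)) (trans (sym (distribʳ w y z)) (*-congʳ (+-comm y z)))

  walks-odd : ∀ h N → walks true h (suc N) ≈ A h * walks false (suc h) N + F h * walks false h N
  walks-odd h N = trans (walks-suc true h N) (+-congˡ (gather _ _ _))

  walks-even : ∀ h N → walks false h (suc N) ≈ B h * walks true (pred h) N + E h * walks true h N
  walks-even h N = trans (walks-suc false h N) (+-congˡ (gather _ _ _))

  private
    evenB-double : ∀ h → evenB (double h) ≡ true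
    evenB-double zero    = ≡.refl
    evenB-double (suc h) = ≡.trans (not-involutive _) (evenB-double h)

    half-double : ∀ h → ⌊ double h /2⌋ ≡ h
    half-double zero    = ≡.refl
    half-double (suc h) = cong suc (half-double h)

  walks≈Jfrac : ∀ {m} n → n < m →
    walks true 0 (2 ℕ.* n) ≈ Jfrac R (αcoef R lam a b c d e f) (δcoef R lam a b c d e f) 1 m n
  walks≈Jfrac n n<m = trans (reflexive (cong (walks true 0) (length n)))
    (JFractions.Contraction.walks≈Jfrac R α δ A B E F α-odd α-even δ-one (λ _ → refl)
      (λ h n → walks true h (double n)) refl (λ _ → refl) step₀ step₊ n n<m)
    where
    α = αcoef R lam a b c d e f
    δ = δcoef R lam a b c d e f
    length : ∀ n → 2 ℕ.* n ≡ double n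
    length zero    = ≡.refl
    length (suc n) = cong suc (≡.trans (ℕP.+-suc n (n ℕ.+ 0)) (cong suc (length n)))
    α-odd : ∀ h → α (suc (double h)) ≈ A h * B (suc h)
    α-odd h = reflexive (≡.trans
      (cong (λ t → if not t then αEven R lam a b c d e f ⌊ suc (double h) /2⌋ else αOdd R lam a b c d e f ⌊ double (suc h) /2⌋) (evenB-double h))
      (cong (λ t → αOdd R lam a b c d e f t) (half-double (suc h))))
    α-even : ∀ h → α (double (suc h)) ≈ E (suc h) * F (suc h)
    α-even h = reflexive (≡.trans
      (cong (λ t → if t then αEven R lam a b c d e f ⌊ double (suc h) /2⌋ else αOdd R lam a b c d e f ⌊ suc (double (suc h)) /2⌋) (evenB-double (suc h)))
      (cong (λ t → αEven R lam a b c d e f t) (half-double (suc h))))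
    δ-one : δ 1 ≈ F 0 * E 0
    δ-one = begin
      lam * lam * e 0 * f 0               ≈⟨ *-congʳ (*-assoc lam lam (e 0)) ⟩
      lam * (lam * e 0) * f 0             ≈⟨ *-assoc _ _ _ ⟩
      lam * (lam * e 0 * f 0)             ≈⟨ *-congˡ (*-comm _ _) ⟩
      lam * (f 0 * (lam * e 0))           ≈⟨ *-assoc _ _ _ ⟨
      -- The sums over `c` and `d` are empty at height zero; only the fixed points remain.
      lam * f 0 * (lam * e 0)             ≈⟨ *-cong (+-identityʳ _) (+-identityʳ _) ⟨
      F 0 * E 0                           ∎
    step₀ : ∀ n → walks true 0 (double (suc n)) ≈
      A 0 * (B 1 * walks true 0 (double n) + E 1 * walks true 1 (double n)) + F 0 * (E 0 * walks true 0 (double n))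
    -- `B 0` is an empty sum, so the peak at height zero drops out.
    step₀ n = trans (walks-odd 0 (suc (double n))) (+-cong (*-congˡ (walks-even 1 (double n)))
      (*-congˡ (trans (walks-even 0 (double n)) (trans (+-congʳ (zeroˡ _)) (+-identityˡ _)))))
    step₊ : ∀ h n → walks true (suc h) (double (suc n)) ≈
      A (suc h) * (B (suc (suc h)) * walks true (suc h) (double n) + E (suc (suc h)) * walks true (suc (suc h)) (double n))
      + F (suc h) * (B (suc h) * walks true h (double n) + E (suc h) * walks true (suc h) (double n))
    step₊ h n = trans (walks-odd (suc h) (suc (double n))) (+-cong (*-congˡ (walks-even (suc (suc h)) (double n)))
      (*-congˡ (walks-even (suc h) (double n))))

-- The statistics of a permutation

T-ext : ∀ {p q} → (T p → T q) → (T q → T p) → p ≡ q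
T-ext {false} {false} f g = ≡.refl
T-ext {false} {true}  f g = contradiction (g tt) λ ()
T-ext {true}  {false} f g = contradiction (f tt) λ ()
T-ext {true}  {true}  f g = ≡.refl

allB-tabulate⁻ : ∀ {A : Set} {n} (p : A → Bool) (g : Fin n → A) → T (allB p (L.tabulate g)) → ∀ i → T (p (g i))
allB-tabulate⁻ p g h zero    = proj₁ (Equivalence.to (T-∧ {p (g zero)}) h)
allB-tabulate⁻ p g h (suc i) = allB-tabulate⁻ p (g ∘ suc) (proj₂ (Equivalence.to (T-∧ {p (g zero)}) h)) i

allB-tabulate⁺ : ∀ {A : Set} {n} (p : A → Bool) (g : Fin n → A) → (∀ i → T (p (g i))) → T (allB p (L.tabulate g))
allB-tabulate⁺ {n = zero}  p g h = tt
allB-tabulate⁺ {n = suc n} p g h = Equivalence.from (T-∧ {p (g zero)}) (h zero , allB-tabulate⁺ p (g ∘ suc) (h ∘ suc))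

allB-upTo⁻ : ∀ {A : Set} (p : A → Bool) g n → T (allB p (applyUpTo g n)) → ∀ k → k < n → T (p (g k))
allB-upTo⁻ p g (suc n) h zero    _         = proj₁ (Equivalence.to (T-∧ {p (g 0)}) h)
allB-upTo⁻ p g (suc n) h (suc k) (s≤s k<n) = allB-upTo⁻ p (g ∘ suc) n (proj₂ (Equivalence.to (T-∧ {p (g 0)}) h)) k k<n

allB-upTo⁺ : ∀ {A : Set} (p : A → Bool) g n → (∀ k → k < n → T (p (g k))) → T (allB p (applyUpTo g n))
allB-upTo⁺ p g zero    h = tt
allB-upTo⁺ p g (suc n) h = Equivalence.from (T-∧ {p (g 0)}) (h 0 (s≤s z≤n) , allB-upTo⁺ p (g ∘ suc) n (λ k k<n → h (suc k) (s≤s k<n)))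

countB-tabulate : ∀ {A : Set} {n} (p : A → Bool) (g : Fin n → A) → countB p (L.tabulate g) ≡ # (λ i → T? (p (g i)))
countB-tabulate {n = zero}  p g = ≡.refl
countB-tabulate {n = suc n} p g with p (g zero)
... | true  = cong suc (countB-tabulate p (g ∘ suc))
... | false = countB-tabulate p (g ∘ suc)

countB-allFin : ∀ {n} (p : Fin n → Bool) {P : Fin n → Set} (P? : ∀ i → Dec (P i)) →
                (∀ i → T (p i) → P i) → (∀ i → P i → T (p i)) → countB p (allFin n) ≡ # P?
countB-allFin p P? to from = ≡.trans (countB-tabulate p (λ i → i)) (#-cong (λ i → T? (p i)) P? to from)

findB-unique : ∀ {A : Set} (p : A → Bool) {k} d xs → k ∈ xs → T (p k) → (∀ j → T (p j) → j ≡ k) → findB p xs d ≡ k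
findB-unique p d (x ∷ xs) k∈ pk unique with p x in eq
... | true  = unique x (subst T (≡.sym eq) tt)
findB-unique p d (x ∷ xs) (here ≡.refl) pk unique | false = contradiction (subst T eq pk) λ ()
findB-unique p d (x ∷ xs) (there k∈)    pk unique | false = findB-unique p d xs k∈ pk unique

∧₃⁻ : ∀ p q {r} → T (p ∧ q ∧ r) → T p × T q × T r
∧₃⁻ true true h = tt , tt , h

∧₃⁺ : ∀ p q {r} → T p → T q → T r → T (p ∧ q ∧ r)
∧₃⁺ true true _ _ h = h

ltB⁻ : ∀ {x y} → T (ltB x y) → x < y
ltB⁻ = toWitness

ltB⁺ : ∀ {x y} → x < y → T (ltB x y)
ltB⁺ = fromWitness

ltB-true : ∀ {x y} → x < y → ltB x y ≡ true
ltB-true h = Equivalence.to T-≡ (ltB⁺ h)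

ltB-false : ∀ {x y} → ¬ x < y → ltB x y ≡ false
ltB-false {x} {y} h = ≡.trans (isYes≗does (x ℕ.<? y)) (dec-false (x ℕ.<? y) h)

eqB-true : ∀ {x y} → x ≡ y → eqB x y ≡ true
eqB-true {x} {y} h = Equivalence.to T-≡ (fromWitness {a? = x ℕ.≟ y} h)

eqB-false : ∀ {x y} → x ≢ y → eqB x y ≡ false
eqB-false {x} {y} h = ≡.trans (isYes≗does (x ℕ.≟ y)) (dec-false (x ℕ.≟ y) h)

-- Kinds read off from a permutation

module _ {N : ℕ} (s : Fin N → Fin N) where

  -- The kind as seen from the map alone, without the order of choices. Fixed points of both
  -- parities share a profile; parity enters through `kind`.
  Profile : Kind → Fin N → Set
  Profile cval    i = i F.< s i × ∃ λ k → i F.< k × s k ≡ i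
  Profile cdrise  i = i F.< s i × ∃ λ k → k F.< i × s k ≡ i
  Profile oddfix  i = s i ≡ i
  Profile cpeak   i = s i F.< i × ∃ λ k → k F.< i × s k ≡ i
  Profile cdfall  i = s i F.< i × ∃ λ k → i F.< k × s k ≡ i
  Profile evenfix i = s i ≡ i

  module _ (inj : Inj s) where

    private
      clash : ∀ {i k l : Fin N} {X : Set} → k F.< i → s k ≡ i → i F.< l → s l ≡ i → X
      clash k<i e i<l e′ = contradiction (inj (≡.trans e (≡.sym e′))) (FP.<⇒≢ (FP.<-trans k<i i<l))
      stuck : ∀ {i j : Fin N} {X : Set} → j ≡ i → i F.< j → X
      stuck e p = contradiction (≡.sym e) (FP.<⇒≢ p)
      stuck′ : ∀ {i j : Fin N} {X : Set} → j ≡ i → j F.< i → X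
      stuck′ e p = contradiction e (FP.<⇒≢ p)

    -- Ensures that a D-permutation is counted for a single sequence of kinds.
    profile-unique : ∀ p x y i → Profile (kind p x) i → Profile (kind p y) i → x ≡ y
    profile-unique _     0F 0F i _ _ = ≡.refl
    profile-unique _     1F 1F i _ _ = ≡.refl
    profile-unique _     2F 2F i _ _ = ≡.refl
    profile-unique true  0F 1F i (_ , _ , p , q) (_ , _ , r , t) = clash r t p q
    profile-unique true  0F 2F i (p , _) e = stuck e p
    profile-unique true  1F 0F i (_ , _ , p , q) (_ , _ , r , t) = clash p q r t
    profile-unique true  1F 2F i (p , _) e = stuck e p
    profile-unique true  2F 0F i e (p , _) = stuck e p
    profile-unique true  2F 1F i e (p , _) = stuck e p
    profile-unique false 0F 1F i (_ , _ , p , q) (_ , _ , r , t) = clash p q r t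
    profile-unique false 0F 2F i (p , _) e = stuck′ e p
    profile-unique false 1F 0F i (_ , _ , p , q) (_ , _ , r , t) = clash r t p q
    profile-unique false 1F 2F i (p , _) e = stuck′ e p
    profile-unique false 2F 0F i e (p , _) = stuck′ e p
    profile-unique false 2F 1F i e (p , _) = stuck′ e p

    profile-exists-odd : ∀ i → i F.≤ s i → ∃ λ x → Profile (kind true x) i
    profile-exists-odd i i≤si with FP.<-cmp (s i) i
    ... | tri< p _ _ = contradiction i≤si (ℕP.<⇒≱ p)
    ... | tri≈ _ e _ = 2F , e
    ... | tri> _ _ p with injective⇒surjective inj i
    ...   | k , e with FP.<-cmp k i
    ...     | tri< q _ _      = 1F , p , k , q , e
    ...     | tri≈ _ ≡.refl _ = stuck e p
    ...     | tri> _ _ q      = 0F , p , k , q , e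

    profile-exists-even : ∀ i → s i F.≤ i → ∃ λ x → Profile (kind false x) i
    profile-exists-even i si≤i with FP.<-cmp (s i) i
    ... | tri> _ _ p = contradiction si≤i (ℕP.<⇒≱ p)
    ... | tri≈ _ e _ = 2F , e
    ... | tri< p _ _ with injective⇒surjective inj i
    ...   | k , e with FP.<-cmp k i
    ...     | tri< q _ _      = 0F , p , k , q , e
    ...     | tri≈ _ ≡.refl _ = stuck′ e p
    ...     | tri> _ _ q      = 1F , p , k , q , e

    module _ (κ : Fin N → Kind) where
      open Order κ

      -- An injective map repeats no value, so nothing chosen earlier blocks `s i`. The position `i`
      -- is the preimage of `s i` and so decides whether the kind there is `Below` or `Above`.
      profile⇒ok : (∀ i → Profile (κ i) i) → ∀ i → Ok s i
      profile⇒ok profile i = byKind (κ i) (profile i)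
        where
        untaken : ¬ Taken i s (s i)
        untaken (k , k≺i , e) = ≺-irrefl i (subst (_≺ i) (inj e) k≺i)
        value-below : i F.< s i → Below (κ (s i))
        value-below i<si with κ (s i) | profile (s i)
        ... | cval    | _ , k , v<k , e = clash i<si ≡.refl v<k e
        ... | cdrise  | _ = tt
        ... | cpeak   | _ = tt
        ... | cdfall  | _ , k , v<k , e = clash i<si ≡.refl v<k e
        ... | oddfix  | e = stuck (inj e) i<si
        ... | evenfix | e = stuck (inj e) i<si
        value-above : s i F.< i → Above (κ (s i))
        value-above si<i with κ (s i) | profile (s i)
        ... | cval    | _ = tt
        ... | cdfall  | _ = tt
        ... | cdrise  | _ , k , k<v , e = clash k<v e si<i ≡.refl
        ... | cpeak   | _ , k , k<v , e = clash k<v e si<i ≡.refl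
        ... | oddfix  | e = stuck′ (inj e) si<i
        ... | evenfix | e = stuck′ (inj e) si<i
        byKind : ∀ k → Profile k i → Allowed i s k (s i)
        byKind cval    (p , _) = (p , value-below p) , untaken
        byKind cdrise  (p , _) = (p , value-below p) , untaken
        byKind cpeak   (p , _) = (p , value-above p) , untaken
        byKind cdfall  (p , _) = (p , value-above p) , untaken
        byKind oddfix  e = e
        byKind evenfix e = e

  module _ (κ : Fin N → Kind) where
    open Order κ

    ok⇒profile : (∀ i → Ok s i) → ∀ i → Profile (κ i) i
    ok⇒profile ok i = byKind (κ i) ≡.refl (ok i)
      where
      preimage : ∃ λ k → s k ≡ i
      preimage = injective⇒surjective (ok-injective (ok _) (ok _)) i
      from-below : Below (κ i) → ∃ λ k → k F.< i × s k ≡ i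
      from-below b with preimage
      ... | k , ≡.refl = k , proj₁ (proj₁ (allowed-up _ (ok-below (ok k) b) (ok k))) , ≡.refl
      from-above : Above (κ i) → ∃ λ k → i F.< k × s k ≡ i
      from-above a with preimage
      ... | k , ≡.refl = k , proj₁ (proj₁ (allowed-down _ (ok-above (ok k) a) (ok k))) , ≡.refl
      byKind : ∀ k → κ i ≡ k → Allowed i s k (s i) → Profile k i
      byKind cval    eq o = proj₁ (proj₁ o) , from-above (subst Above (≡.sym eq) tt)
      byKind cdrise  eq o = proj₁ (proj₁ o) , from-below (subst Below (≡.sym eq) tt)
      byKind cpeak   eq o = proj₁ (proj₁ o) , from-below (subst Below (≡.sym eq) tt)
      byKind cdfall  eq o = proj₁ (proj₁ o) , from-above (subst Above (≡.sym eq) tt)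
      byKind oddfix  eq o = o
      byKind evenfix eq o = o

-- Crossings and nestings as ranks, cycle minima as returning walks

module Statistics {N : ℕ} (σ : Vec (Fin N) N) (κ : Fin N → Kind) where
  open Order κ

  private
    g : Fin N → Fin N
    g = lookup σ

  module _ (ok : ∀ i → Ok g i) where

    private
      inj : Inj g
      inj = ok-injective (ok _) (ok _)

      excedance⇒up : ∀ {j} → j F.< g j → Up (κ j)
      excedance⇒up {j} j<gj with up? (κ j) | down? (κ j)
      ... | yes u | _     = u
      ... | no _  | yes d = contradiction (proj₁ (proj₁ (allowed-down _ d (ok j)))) (FP.<-asym j<gj)
      ... | no ¬u | no ¬d = contradiction (≡.sym (allowed-fix _ ¬u ¬d (ok j))) (FP.<⇒≢ j<gj)

      deficiency⇒down : ∀ {j} → g j F.< j → Down (κ j)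
      deficiency⇒down {j} gj<j with up? (κ j) | down? (κ j)
      ... | _     | yes d = d
      ... | yes u | no _  = contradiction (proj₁ (proj₁ (allowed-up _ u (ok j)))) (FP.<-asym gj<j)
      ... | no ¬u | no ¬d = contradiction (allowed-fix _ ¬u ¬d (ok j)) (FP.<⇒≢ gj<j)

    -- A value free at the turn of `i` belongs to `i` or to a later position; for excedance values
    -- and a non-deficiency `i`, later means left of `i`.
    freeAbove⁻ : ∀ {i j} → ¬ Down (κ i) → j ≢ i → FreeAbove i g (g j) → j F.< i × i F.< g j
    freeAbove⁻ {i} {j} ¬di j≢i ((i<gj , b) , ¬taken) with ≺-connex j i j≢i
    ... | inj₁ j≺i = contradiction (j , j≺i , ≡.refl) ¬taken
    ... | inj₂ i≺j = ≺-¬down ¬di i≺j , i<gj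

    freeAbove⁺ : ∀ {i j} → ¬ Down (κ i) → j F.< i → i F.< g j → FreeAbove i g (g j)
    freeAbove⁺ {i} {j} ¬di j<i i<gj = (i<gj , proj₂ (proj₁ (allowed-up _ up-j (ok j)))) , untaken
      where
      up-j = excedance⇒up (FP.<-trans j<i i<gj)
      untaken : ¬ Taken i g (g j)
      untaken (k , k≺i , e) with inj e
      ... | ≡.refl = FP.<-asym j<i (≺-¬down (up⇒¬down _ up-j) k≺i)

    -- For the values of deficiencies, later means right of `i`.
    freeBelow⁻ : ∀ {i l} → l ≢ i → FreeBelow i g (g l) → g l F.< i × i F.< l
    freeBelow⁻ {i} {l} l≢i ((gl<i , a) , ¬taken) with ≺-connex l i l≢i
    ... | inj₁ l≺i = contradiction (l , l≺i , ≡.refl) ¬taken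
    ... | inj₂ i≺l = gl<i , proj₂ (≺-down (ok-above (ok l) a) i≺l)

    freeBelow⁺ : ∀ {i l} → Down (κ i) → g l F.< i → i F.< l → FreeBelow i g (g l)
    freeBelow⁺ {i} {l} di gl<i i<l =
      (gl<i , proj₂ (proj₁ (allowed-down _ (deficiency⇒down (FP.<-trans gl<i i<l)) (ok l)))) , untaken
      where
      untaken : ¬ Taken i g (g l)
      untaken (k , k≺i , e) with inj e
      ... | ≡.refl = FP.<-asym i<l (proj₂ (≺-down di k≺i))

    private
      l⁻ : ∀ {i j : Fin N} → T (ltB (suc (toℕ i)) (suc (toℕ j))) → i F.< j
      l⁻ h = ℕP.≤-pred (ltB⁻ h)
      l⁺ : ∀ {i j : Fin N} → i F.< j → T (ltB (suc (toℕ i)) (suc (toℕ j)))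
      l⁺ h = ltB⁺ (s≤s h)

    module _ {i : Fin N} where

      -- Replacing a position `j` by its value `g j` turns the crossing arcs into free values below
      -- `g i`; the strict comparison excludes `j` = `i`.
      ucross≡ : Up (κ i) → ucross σ i ≡ #below (freeAbove? i g) (g i)
      ucross≡ u = ≡.sym (≡.trans (#-injective inj (λ v → (v F.<? g i) ×-dec freeAbove? i g v))
        (≡.sym (countB-allFin _ (λ j → (g j F.<? g i) ×-dec freeAbove? i g (g j))
          (λ j h → let p , q , r = ∧₃⁻ (ltB (pos σ j) (pos σ i)) (ltB (pos σ i) (s σ j)) h
                   in l⁻ r , freeAbove⁺ (up⇒¬down _ u) (l⁻ p) (l⁻ q))
          (λ j (r , fr) → let p , q = freeAbove⁻ (up⇒¬down _ u) (λ { ≡.refl → FP.<-irrefl ≡.refl r }) fr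
                          in ∧₃⁺ (ltB (pos σ j) (pos σ i)) (ltB (pos σ i) (s σ j)) (l⁺ p) (l⁺ q) (l⁺ r)))))

      unest≡ : Up (κ i) → unest σ i ≡ #above (freeAbove? i g) (g i)
      unest≡ u = ≡.sym (≡.trans (#-injective inj (λ v → (g i F.<? v) ×-dec freeAbove? i g v))
        (≡.sym (countB-allFin _ (λ j → (g i F.<? g j) ×-dec freeAbove? i g (g j))
          (λ j h → let p , q , r = ∧₃⁻ (ltB (pos σ j) (pos σ i)) (ltB (pos σ i) (s σ i)) h
                   in l⁻ r , freeAbove⁺ (up⇒¬down _ u) (l⁻ p) (FP.<-trans (l⁻ q) (l⁻ r)))
          (λ j (r , fr) → let p , _ = freeAbove⁻ (up⇒¬down _ u) (λ { ≡.refl → FP.<-irrefl ≡.refl r }) fr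
                          in ∧₃⁺ (ltB (pos σ j) (pos σ i)) (ltB (pos σ i) (s σ i)) (l⁺ p) (l⁺ (proj₁ (proj₁ (allowed-up _ u (ok i))))) (l⁺ r)))))

      lcross≡ : Down (κ i) → lcross σ i ≡ #above (freeBelow? i g) (g i)
      lcross≡ d = ≡.sym (≡.trans (#-injective inj (λ v → (g i F.<? v) ×-dec freeBelow? i g v))
        (≡.sym (countB-allFin _ (λ j → (g i F.<? g j) ×-dec freeBelow? i g (g j))
          (λ j h → let p , q , r = ∧₃⁻ (ltB (s σ i) (s σ j)) (ltB (s σ j) (pos σ i)) h
                   in l⁻ p , freeBelow⁺ d (l⁻ q) (l⁻ r))
          (λ j (p , fr) → let q , r = freeBelow⁻ (λ { ≡.refl → FP.<-irrefl ≡.refl p }) fr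
                          in ∧₃⁺ (ltB (s σ i) (s σ j)) (ltB (s σ j) (pos σ i)) (l⁺ p) (l⁺ q) (l⁺ r)))))

      lnest≡ : Down (κ i) → lnest σ i ≡ #below (freeBelow? i g) (g i)
      lnest≡ d = ≡.sym (≡.trans (#-injective inj (λ v → (v F.<? g i) ×-dec freeBelow? i g v))
        (≡.sym (countB-allFin _ (λ j → (g j F.<? g i) ×-dec freeBelow? i g (g j))
          (λ j h → let p , q , r = ∧₃⁻ (ltB (s σ j) (s σ i)) (ltB (s σ i) (pos σ i)) h
                   in l⁻ p , freeBelow⁺ d (FP.<-trans (l⁻ p) (l⁻ q)) (l⁻ r))
          (λ j (p , fr) → let _ , r = freeBelow⁻ (λ { ≡.refl → FP.<-irrefl ≡.refl p }) fr
                          in ∧₃⁺ (ltB (s σ j) (s σ i)) (ltB (s σ i) (pos σ i)) (l⁺ p) (l⁺ (proj₁ (proj₁ (allowed-down _ d (ok i))))) (l⁺ r)))))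

      psnest≡ : ¬ Down (κ i) → g i ≡ i → psnest σ i ≡ # (freeAbove? i g)
      psnest≡ ¬di fixed = ≡.sym (≡.trans (#-injective inj (freeAbove? i g))
        (≡.sym (countB-allFin _ (λ j → freeAbove? i g (g j))
          (λ j h → let p , q = Equivalence.to (T-∧ {ltB (pos σ j) (pos σ i)}) h in freeAbove⁺ ¬di (l⁻ p) (l⁻ q))
          (λ j fr → let p , q = freeAbove⁻ ¬di (λ { ≡.refl → FP.<-irrefl (≡.sym fixed) (proj₁ (proj₁ fr)) }) fr
                    in Equivalence.from (T-∧ {ltB (pos σ j) (pos σ i)}) (l⁺ p , l⁺ q)))))

      -- The two ranks together count the rivals of the chosen value, whichever value was chosen.
      ucross+unest≡ : Up (κ i) → ucross σ i ℕ.+ unest σ i ≡ # (freeAbove? i g) ∸ 1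
      ucross+unest≡ u = ≡.trans (cong₂ ℕ._+_ (ucross≡ u) (unest≡ u))
        (cong (_∸ 1) (#-split (freeAbove? i g) (g i) (allowed-up _ u (ok i))))

      sinv≡ : ∀ {k} → g k ≡ i → sinv σ i ≡ pos σ k
      sinv≡ {k} gk≡i = cong (pos σ) (findB-unique (λ j → eqB (s σ j) (pos σ i)) i (allFin N) (MemP.∈-allFin k)
        (fromWitness {a? = s σ k ℕ.≟ pos σ i} (cong (pos σ) gk≡i))
        (λ j h → inj (≡.trans (FP.toℕ-injective (ℕP.suc-injective (toWitness {a? = s σ j ℕ.≟ pos σ i} h))) (≡.sym gk≡i))))

      isCycleMin : Bool
      isCycleMin = allB (λ k → leB (pos σ i) (pos σ (iter σ (suc k) i))) (upTo N)

      isCycleMin⁻ : T isCycleMin → ∀ k → k < N → i F.≤ iter σ (suc k) i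
      isCycleMin⁻ h k k<N = ℕP.≤-pred (toWitness {a? = pos σ i ℕ.≤? pos σ (iter σ (suc k) i)}
        (allB-upTo⁻ (λ k → leB (pos σ i) (pos σ (iter σ (suc k) i))) (λ k → k) N h k k<N))

      isCycleMin⁺ : (∀ k → i F.≤ iter σ (suc k) i) → T isCycleMin
      isCycleMin⁺ h = allB-upTo⁺ (λ k → leB (pos σ i) (pos σ (iter σ (suc k) i))) (λ k → k) N
        (λ k _ → fromWitness {a? = pos σ i ℕ.≤? pos σ (iter σ (suc k) i)} (s≤s (h k)))

      private
        iter-cancel : ∀ p r → iter σ (p ℕ.+ r) i ≡ iter σ p i → iter σ r i ≡ i
        iter-cancel zero    r e = e
        iter-cancel (suc p) r e = iter-cancel p r (inj e)

      -- Two of the first N + 1 iterates coincide, and injectivity cancels their common initial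
      -- steps.
      periodic : ∃ λ p → p < N × iter σ (suc p) i ≡ i
      periodic =
        let j , k , j<k , e = FP.pigeonhole (ℕP.n<1+n N) (λ (j : Fin (suc N)) → iter σ (toℕ j) i)
            r , j+r≡k = ℕP.m≤n⇒∃[o]m+o≡n j<k
            k≡ = ≡.trans (ℕP.+-suc (toℕ j) r) j+r≡k
        in r , ℕP.≤-trans (ℕP.m≤n+m (suc r) (toℕ j)) (ℕP.≤-trans (ℕP.≤-reflexive k≡) (FP.toℕ≤pred[n] k)) ,
           iter-cancel (toℕ j) (suc r) (≡.trans (cong (λ t → iter σ t i) k≡) (≡.sym e))

      cycleMin-deficiency : g i F.< i → isCycleMin ≡ false
      cycleMin-deficiency gi<i = T-ext
        (λ h → contradiction (isCycleMin⁻ h 0 (ℕP.≤-<-trans z≤n (FP.toℕ<n i))) (ℕP.<⇒≱ gi<i)) λ ()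

      -- The smaller point `k` lies on the same cycle: it is the iterate just before the return to
      -- `i`.
      cycleMin-cdrise : ∀ {k} → k F.< i → g k ≡ i → isCycleMin ≡ false
      cycleMin-cdrise {k} k<i gk≡i = T-ext absurd λ ()
        where
        absurd : T isCycleMin → T false
        absurd h with periodic
        ... | zero  , _   , e = contradiction (inj (≡.trans gk≡i (≡.sym e))) (FP.<⇒≢ k<i)
        ... | suc p , p<N , e = contradiction (isCycleMin⁻ h p (ℕP.<-trans (ℕP.n<1+n p) p<N))
              (ℕP.<⇒≱ (subst (F._< i) (inj (≡.trans gk≡i (≡.sym e))) k<i))

      cycleMin-fix : g i ≡ i → isCycleMin ≡ true
      cycleMin-fix e = Equivalence.to T-≡ (isCycleMin⁺ (λ k → FP.≤-reflexive (≡.sym (fixed (suc k)))))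
        where
        fixed : ∀ k → iter σ k i ≡ i
        fixed zero    = ≡.refl
        fixed (suc k) = ≡.trans (cong g (fixed k)) e

      cycleMin-cval : isCycleMin ≡ does (closes? i g (g i))
      cycleMin-cval = ≡.trans (T-ext (λ h → fromWitness (closes h)) (λ h → minimal (toWitness h))) (isYes≗does (closes? i g (g i)))
        where
        closes : T isCycleMin → Closes i g (g i)
        closes h with periodic
        ... | p , p<N , e = let r , reach = back p 0 (ℕP.+-identityʳ p) in reach⇒closes i g r reach
          where
          -- `d` steps remain until a known return. An earlier visit to `i` ends the walk at once,
          -- because `Reach` may not pass through `i`.
          back : ∀ d k → d ℕ.+ k ≡ p → ∃ λ r → Reach i g r (iter σ (suc k) i)
          back zero    k ≡.refl = 0 , e
          back (suc d) k d+k≡p with iter σ (suc k) i FP.≟ i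
          ... | yes x≡i = 0 , x≡i
          ... | no  x≢i = let r , reach = back d (suc k) (≡.trans (ℕP.+-suc d k) d+k≡p)
                          in suc r , FP.≤∧≢⇒< (isCycleMin⁻ h k (ℕP.≤-<-trans (ℕP.≤-trans (ℕP.m≤n+m k (suc d)) (ℕP.≤-reflexive d+k≡p)) p<N)) (x≢i ∘ ≡.sym) , reach
        minimal : Closes i g (g i) → T isCycleMin
        minimal (r₀ , reach₀) = isCycleMin⁺ (λ k → let r , reach = orbit k in reach-≥ i g r reach)
          where
          -- Every iterate still leads to `i` through points above it; at `i` itself the walk starts
          -- afresh with `r₀` steps.
          orbit : ∀ k → ∃ λ r → Reach i g r (iter σ (suc k) i)
          orbit zero = toℕ r₀ , reach₀
          orbit (suc k) with orbit k
          ... | zero  , x≡i       = toℕ r₀ , subst (λ x → Reach i g (toℕ r₀) (g x)) (≡.sym x≡i) reach₀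
          ... | suc r , _ , reach = r , reach

-- The sum over D-permutations

kinds-lookup : ∀ {N} p (τ : Vec (Fin 3) N) i →
               kinds p τ i ≡ kind (if evenB (toℕ i) then p else not p) (lookup τ i)
kinds-lookup p (x ∷ τ) zero    = ≡.refl
kinds-lookup p (x ∷ τ) (suc i) = ≡.trans (kinds-lookup (not p) τ i)
  (cong (λ q → kind q (lookup τ i)) (flip (evenB (toℕ i))))
  where
  flip : ∀ q → (if q then not p else not (not p)) ≡ (if not q then p else not p)
  flip true  = ≡.refl
  flip false = not-involutive p

kinds-odd : ∀ {N} (τ : Vec (Fin 3) N) i → kinds true τ i ≡ kind (evenB (toℕ i)) (lookup τ i)
kinds-odd τ i = ≡.trans (kinds-lookup true τ i) (cong (λ q → kind q (lookup τ i)) (simplify (evenB (toℕ i))))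
  where
  simplify : ∀ q → (if q then true else false) ≡ q
  simplify true  = ≡.refl
  simplify false = ≡.refl

module _ {N : ℕ} (σ : Vec (Fin N) N) where

  private
    g : Fin N → Fin N
    g = lookup σ

    distinct : Fin N → Fin N → Bool
    distinct i j = not (eqB (s σ i) (s σ j)) ∨ eqB (pos σ i) (pos σ j)

  isPerm⁻ : T (isPerm σ) → Inj g
  isPerm⁻ h {i} {j} e with Equivalence.to (T-∨ {not (eqB (s σ i) (s σ j))})
      (allB-tabulate⁻ (distinct i) (λ j → j) (allB-tabulate⁻ (λ i → allB (distinct i) (allFin N)) (λ i → i) h i) j)
  ... | inj₂ p = FP.toℕ-injective (ℕP.suc-injective (toWitness {a? = pos σ i ℕ.≟ pos σ j} p))
  ... | inj₁ p = contradiction (subst T (cong not (eqB-true (cong (pos σ) e))) p) λ ()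

  isPerm⁺ : Inj g → T (isPerm σ)
  isPerm⁺ inj = allB-tabulate⁺ (λ i → allB (distinct i) (allFin N)) (λ i → i) λ i →
    allB-tabulate⁺ (distinct i) (λ j → j) (λ j → Equivalence.from (T-∨ {not (eqB (s σ i) (s σ j))}) (compare i j))
    where
    compare : ∀ i j → T (not (eqB (s σ i) (s σ j))) ⊎ T (eqB (pos σ i) (pos σ j))
    compare i j with g i FP.≟ g j
    ... | yes e = inj₂ (fromWitness {a? = pos σ i ℕ.≟ pos σ j} (cong (pos σ) (inj e)))
    ... | no ne = inj₁ (Equivalence.from T-not-≡ (eqB-false (ne ∘ FP.toℕ-injective ∘ ℕP.suc-injective)))

  private
    bounded : Fin N → Bool
    bounded i = if evenB (pos σ i) then leB (s σ i) (pos σ i) else leB (pos σ i) (s σ i)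

  isD⇒profile : T (isD σ) → Inj g → ∀ i → ∃ λ x → Profile g (kind (evenB (toℕ i)) x) i
  isD⇒profile h inj i with evenB (toℕ i) | allB-tabulate⁻ bounded (λ i → i) h i
  ... | true  | p = profile-exists-odd  g inj i (ℕP.≤-pred (toWitness {a? = pos σ i ℕ.≤? s σ i} p))
  ... | false | p = profile-exists-even g inj i (ℕP.≤-pred (toWitness {a? = s σ i ℕ.≤? pos σ i} p))

  profile⇒isD : (∀ i → ∃ λ x → Profile g (kind (evenB (toℕ i)) x) i) → T (isD σ)
  profile⇒isD profile = allB-tabulate⁺ bounded (λ i → i) bound
    where
    ≤-even : ∀ x i → Profile g (kind false x) i → g i F.≤ i
    ≤-even zero             i (p , _) = ℕP.<⇒≤ p
    ≤-even (suc zero)       i (p , _) = ℕP.<⇒≤ p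
    ≤-even (suc (suc zero)) i e       = FP.≤-reflexive e
    ≥-odd : ∀ x i → Profile g (kind true x) i → i F.≤ g i
    ≥-odd zero             i (p , _) = ℕP.<⇒≤ p
    ≥-odd (suc zero)       i (p , _) = ℕP.<⇒≤ p
    ≥-odd (suc (suc zero)) i e       = FP.≤-reflexive (≡.sym e)
    bound : ∀ i → T (bounded i)
    bound i with evenB (toℕ i) | profile i
    ... | true  | x , p = fromWitness {a? = pos σ i ℕ.≤? s σ i} (s≤s (≥-odd x i p))
    ... | false | x , p = fromWitness {a? = s σ i ℕ.≤? pos σ i} (s≤s (≤-even x i p))

module Assembly {ℓ₁ ℓ₂ : Level} (R : CommutativeRing ℓ₁ ℓ₂)
  (lam : CommutativeRing.Carrier R) (a : ℕ → CommutativeRing.Carrier R)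
  (b c d : ℕ → ℕ → CommutativeRing.Carrier R) (e f : ℕ → CommutativeRing.Carrier R) where
  open CommutativeRing R hiding (zero)
  open RingSums R
  open VecSums R
  open Weights R lam a b c d e f
  open Paths R lam a b c d e f
  open import Relation.Binary.Reasoning.Setoid setoid

  sumR-++ : ∀ xs ys → sumR R (xs ++ ys) ≈ sumR R xs + sumR R ys
  sumR-++ []       ys = sym (+-identityˡ _)
  sumR-++ (x ∷ xs) ys = trans (+-congˡ (sumR-++ xs ys)) (sym (+-assoc _ _ _))

  sumR-filter : ∀ {X : Set} (p : X → Bool) (t : X → Carrier) xs →
                sumR R (L.map t (filterᵇ p xs)) ≈ sumR R (L.map (λ x → if p x then t x else 0#) xs)
  sumR-filter p t []       = refl
  sumR-filter p t (x ∷ xs) with p x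
  ... | true  = +-congˡ (sumR-filter p t xs)
  ... | false = trans (sumR-filter p t xs) (sym (+-identityˡ _))

  sumR-concatMap : ∀ {X Y : Set} (t : Y → Carrier) (h : X → List Y) {n} (x : Fin n → X) →
                   sumR R (L.map t (concatMap h (L.tabulate x))) ≈ ∑ (λ i → sumR R (L.map t (h (x i))))
  sumR-concatMap t h {zero}  x = refl
  sumR-concatMap t h {suc n} x = begin
    sumR R (L.map t (h (x zero) ++ concatMap h (L.tabulate (x ∘ suc))))   ≡⟨ cong (sumR R) (LP.map-++ t (h (x zero)) _) ⟩
    sumR R (L.map t (h (x zero)) ++ _)                                   ≈⟨ sumR-++ (L.map t (h (x zero))) _ ⟩
    sumR R (L.map t (h (x zero))) + sumR R (L.map t (concatMap h (L.tabulate (x ∘ suc)))) ≈⟨ +-congˡ (sumR-concatMap t h (x ∘ suc)) ⟩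
    _ ∎

  sumR-allVecs : ∀ k m (t : Vec (Fin m) k → Carrier) → sumR R (L.map t (allVecs k m)) ≈ ∑ᵛ t
  sumR-allVecs zero    m t = +-identityʳ _
  sumR-allVecs (suc k) m t = trans (sumR-concatMap t (λ i → L.map (i ∷_) (allVecs k m)) {m} (λ i → i))
    (∑-cong {m} λ i → trans (reflexive (cong (sumR R) (≡.sym (LP.map-∘ (allVecs k m))))) (sumR-allVecs k m (λ σ → t (i ∷ σ))))

  powR-countB : ∀ {N} x (p : Fin N → Bool) → powR R x (countB p (allFin N)) ≈ ∏ (λ i → if p i then x else 1#)
  powR-countB x p = go (λ i → i)
    where
    go : ∀ {n} (h : Fin n → _) → powR R x (countB p (L.tabulate h)) ≈ ∏ (λ i → if p (h i) then x else 1#)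
    go {zero}  h = refl
    go {suc n} h with p (h zero)
    ... | true  = *-congˡ (go (h ∘ suc))
    ... | false = trans (go (h ∘ suc)) (sym (*-identityˡ _))

  positionWeight : ∀ {N} → Vec (Fin N) N → Fin N → Carrier
  positionWeight σ i = when R (isCval σ i) (a (ucross σ i ℕ.+ unest σ i))
    * (when R (isCpeak σ i) (b (lcross σ i) (lnest σ i))
    * (when R (isCdfall σ i) (c (lcross σ i) (lnest σ i))
    * (when R (isCdrise σ i) (d (ucross σ i) (unest σ i))
    * (when R (isEvenfix σ i) (e (psnest σ i))
    * when R (isOddfix σ i) (f (psnest σ i))))))

  permWeight : ∀ {N} → Vec (Fin N) N → Carrier
  permWeight {N} σ = powR R lam (cyc σ) * prodR R (L.map (positionWeight σ) (allFin N))

  module _ {N : ℕ} (σ : Vec (Fin N) N) (τ : Vec (Fin 3) N) (ok : ∀ i → Order.Ok (kinds true τ) (lookup σ) i) where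

    private
      κ : Fin N → Kind
      κ = kinds true τ
      g : Fin N → Fin N
      g = lookup σ
      inj : Inj g
      inj = Local.ok⇒injective κ ok
    open Order κ
    open Statistics σ κ

    private
      -- The tests become variables, so that the product computes once their values are known: five
      -- of the six factors are then 1.
      select : (inv< σ< <inv <σ σ= even : Bool) → (A′ B′ C′ D′ E′ F′ : Carrier) → Carrier
      select inv< σ< <inv <σ σ= even A′ B′ C′ D′ E′ F′ =
        when R (<inv ∧ <σ) A′ * (when R (inv< ∧ σ<) B′ * (when R (<inv ∧ σ<) C′ * (when R (inv< ∧ <σ) D′
        * (when R (σ= ∧ even) E′ * when R (σ= ∧ not even) F′))))

      positionWeight-select : ∀ i {inv< σ< <inv <σ σ= even} →
        ltB (sinv σ i) (pos σ i) ≡ inv< → ltB (s σ i) (pos σ i) ≡ σ< →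
        ltB (pos σ i) (sinv σ i) ≡ <inv → ltB (pos σ i) (s σ i) ≡ <σ →
        eqB (s σ i) (pos σ i) ≡ σ= → evenB (pos σ i) ≡ even →
        positionWeight σ i ≡ select inv< σ< <inv <σ σ= even
          (a (ucross σ i ℕ.+ unest σ i)) (b (lcross σ i) (lnest σ i)) (c (lcross σ i) (lnest σ i))
          (d (ucross σ i) (unest σ i)) (e (psnest σ i)) (f (psnest σ i))
      positionWeight-select i ≡.refl ≡.refl ≡.refl ≡.refl ≡.refl ≡.refl = ≡.refl

      one = *-identityˡ
      last : ∀ x → x * (1# * 1#) ≈ x
      last x = trans (*-congˡ (one 1#)) (*-identityʳ x)

      inv-true : ∀ {i k} → g k ≡ i → k F.< i → ltB (sinv σ i) (pos σ i) ≡ true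
      inv-true {i} gk≡i k<i = ≡.trans (cong (λ t → ltB t (pos σ i)) (sinv≡ ok gk≡i)) (ltB-true (s≤s k<i))
      inv-false : ∀ {i k} → g k ≡ i → ¬ k F.< i → ltB (sinv σ i) (pos σ i) ≡ false
      inv-false {i} gk≡i k≮i = ≡.trans (cong (λ t → ltB t (pos σ i)) (sinv≡ ok gk≡i)) (ltB-false (k≮i ∘ ℕP.≤-pred))
      inv-true′ : ∀ {i k} → g k ≡ i → i F.< k → ltB (pos σ i) (sinv σ i) ≡ true
      inv-true′ {i} gk≡i i<k = ≡.trans (cong (ltB (pos σ i)) (sinv≡ ok gk≡i)) (ltB-true (s≤s i<k))
      inv-false′ : ∀ {i k} → g k ≡ i → ¬ i F.< k → ltB (pos σ i) (sinv σ i) ≡ false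
      inv-false′ {i} gk≡i i≮k = ≡.trans (cong (ltB (pos σ i)) (sinv≡ ok gk≡i)) (ltB-false (i≮k ∘ ℕP.≤-pred))
      <-true : ∀ {i j : Fin N} → i F.< j → ltB (pos σ i) (pos σ j) ≡ true
      <-true p = ltB-true (s≤s p)
      <-false : ∀ {i j : Fin N} → ¬ i F.< j → ltB (pos σ i) (pos σ j) ≡ false
      <-false p = ltB-false (p ∘ ℕP.≤-pred)
      ≢-false : ∀ {i j : Fin N} → i ≢ j → eqB (pos σ i) (pos σ j) ≡ false
      ≢-false p = eqB-false (p ∘ FP.toℕ-injective ∘ ℕP.suc-injective)

    cycleWeight : Fin N → Carrier
    cycleWeight i = if isCycleMin ok {i} then lam else 1#

    private
      cycleWeight≡ : ∀ i {p} → isCycleMin ok {i} ≡ p → cycleWeight i ≡ (if p then lam else 1#)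
      cycleWeight≡ i eq = cong (λ p → if p then lam else 1#) eq

      oddfix-odd : ∀ i → κ i ≡ oddfix → evenB (pos σ i) ≡ false
      oddfix-odd i κi with evenB (toℕ i) | lookup τ i | ≡.trans (≡.sym (kinds-odd τ i)) κi
      ... | true  | _                  | _ = ≡.refl
      ... | false | zero               | ()
      ... | false | suc zero           | ()
      ... | false | suc (suc zero)     | ()

      evenfix-even : ∀ i → κ i ≡ evenfix → evenB (pos σ i) ≡ true
      evenfix-even i κi with evenB (toℕ i) | lookup τ i | ≡.trans (≡.sym (kinds-odd τ i)) κi
      ... | false | _                  | _ = ≡.refl
      ... | true  | zero               | ()
      ... | true  | suc zero           | ()
      ... | true  | suc (suc zero)     | ()

      -- Deficiencies and cyclic rises are never cycle minima, fixed points always are, and a valley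
      -- is one exactly when its value closes a cycle.
      localWeight-match : ∀ i k → κ i ≡ k → Profile g k i → cycleWeight i * positionWeight σ i ≈ Local.localWeight κ k i g (g i)
      localWeight-match i cval κi (i<gi , k , i<k , gk≡i) = *-cong
        (reflexive (cycleWeight≡ i (cycleMin-cval ok)))
        (trans (reflexive (positionWeight-select i
            (inv-false gk≡i (FP.<-asym i<k)) (<-false (FP.<-asym i<gi)) (inv-true′ gk≡i i<k) (<-true i<gi)
            (≢-false (≡.≢-sym (FP.<⇒≢ i<gi))) ≡.refl))
          (trans (*-congˡ (trans (one _) (trans (one _) (trans (one _) (one 1#))))) (trans (*-identityʳ _)
            (reflexive (cong a (ucross+unest≡ ok (subst Up (≡.sym κi) tt)))))))
      localWeight-match i cdrise κi (i<gi , k , k<i , gk≡i) = trans (*-cong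
        (reflexive (cycleWeight≡ i (cycleMin-cdrise ok k<i gk≡i)))
        (trans (reflexive (positionWeight-select i
            (inv-true gk≡i k<i) (<-false (FP.<-asym i<gi)) (inv-false′ gk≡i (FP.<-asym k<i)) (<-true i<gi)
            (≢-false (≡.≢-sym (FP.<⇒≢ i<gi))) ≡.refl))
          (trans (one _) (trans (one _) (trans (one _) (last _))))))
        (trans (one _) (reflexive (cong₂ d (ucross≡ ok (subst Up (≡.sym κi) tt)) (unest≡ ok (subst Up (≡.sym κi) tt)))))
      localWeight-match i cpeak κi (gi<i , k , k<i , gk≡i) = trans (*-cong
        (reflexive (cycleWeight≡ i (cycleMin-deficiency ok gi<i)))
        (trans (reflexive (positionWeight-select i
            (inv-true gk≡i k<i) (<-true gi<i) (inv-false′ gk≡i (FP.<-asym k<i)) (<-false (FP.<-asym gi<i))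
            (≢-false (FP.<⇒≢ gi<i)) ≡.refl))
          (trans (one _) (trans (*-congˡ (trans (one _) (one _))) (last _)))))
        (trans (one _) (reflexive (cong₂ b (lcross≡ ok (subst Down (≡.sym κi) tt)) (lnest≡ ok (subst Down (≡.sym κi) tt)))))
      localWeight-match i cdfall κi (gi<i , k , i<k , gk≡i) = trans (*-cong
        (reflexive (cycleWeight≡ i (cycleMin-deficiency ok gi<i)))
        (trans (reflexive (positionWeight-select i
            (inv-false gk≡i (FP.<-asym i<k)) (<-true gi<i) (inv-true′ gk≡i i<k) (<-false (FP.<-asym gi<i))
            (≢-false (FP.<⇒≢ gi<i)) ≡.refl))
          (trans (one _) (trans (one _) (trans (*-congˡ (one _)) (last _))))))
        (trans (one _) (reflexive (cong₂ c (lcross≡ ok (subst Down (≡.sym κi) tt)) (lnest≡ ok (subst Down (≡.sym κi) tt)))))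
      localWeight-match i oddfix κi gi≡i = *-cong
        (reflexive (cycleWeight≡ i (cycleMin-fix ok gi≡i)))
        (trans (reflexive (positionWeight-select i
            (inv-false gi≡i (FP.<-irrefl ≡.refl)) (<-false (FP.<-irrefl gi≡i)) (inv-false′ gi≡i (FP.<-irrefl ≡.refl)) (<-false (FP.<-irrefl (≡.sym gi≡i)))
            (eqB-true (cong (pos σ) gi≡i)) (oddfix-odd i κi)))
          (trans (one _) (trans (one _) (trans (one _) (trans (one _) (trans (one _)
            (reflexive (cong f (psnest≡ ok (subst (¬_ ∘ Down) (≡.sym κi) λ ()) gi≡i)))))))))
      localWeight-match i evenfix κi gi≡i = *-cong
        (reflexive (cycleWeight≡ i (cycleMin-fix ok gi≡i)))
        (trans (reflexive (positionWeight-select i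
            (inv-false gi≡i (FP.<-irrefl ≡.refl)) (<-false (FP.<-irrefl gi≡i)) (inv-false′ gi≡i (FP.<-irrefl ≡.refl)) (<-false (FP.<-irrefl (≡.sym gi≡i)))
            (eqB-true (cong (pos σ) gi≡i)) (evenfix-even i κi)))
          (trans (one _) (trans (one _) (trans (one _) (trans (one _) (trans (*-identityʳ _)
            (reflexive (cong e (psnest≡ ok (subst (¬_ ∘ Down) (≡.sym κi) λ ()) gi≡i)))))))))

    -- `cyc` counts cycle minima, so the power of λ distributes over the positions and merges with
    -- their weights.
    permWeight≈∏-factor : permWeight σ ≈ ∏ (λ i → Local.factor κ i g)
    permWeight≈∏-factor = begin
      powR R lam (cyc σ) * prodR R (L.map (positionWeight σ) (allFin N))
        ≈⟨ *-cong (powR-countB lam (λ i → isCycleMin ok {i})) (prodOver-allFin (positionWeight σ)) ⟩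
      ∏ cycleWeight * ∏ (positionWeight σ)           ≈⟨ ∏-* cycleWeight (positionWeight σ) ⟨
      ∏ (λ i → cycleWeight i * positionWeight σ i)   ≈⟨ ∏-cong {N} (λ i → trans (localWeight-match i (κ i) ≡.refl (ok⇒profile g κ ok i)) (sym (factor-ok i))) ⟩
      ∏ (λ i → Local.factor κ i g)                   ∎
      where
      factor-ok : ∀ i → Local.factor κ i g ≈ Local.localWeight κ (κ i) i g (g i)
      factor-ok i = reflexive (cong (λ t → if t then Local.localWeight κ (κ i) i g (g i) else 0#) (dec-true (ok? g i) (ok i)))

  -- Exactly one sequence of kinds fits a D-permutation and none fits any other map; a misfit has a
  -- vanishing factor.
  permWeight-split : ∀ {N} (σ : Vec (Fin N) N) →
    (if isPerm σ ∧ isD σ then permWeight σ else 0#) ≈ ∑ᵛ {N} {3} (λ τ → ∏ (λ i → Local.factor (kinds true τ) i (lookup σ)))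
  permWeight-split {N} σ with T? (isPerm σ ∧ isD σ)
  ... | no ¬h = trans (reflexive (cong (λ t → if t then permWeight σ else 0#) (T-ext ¬h λ ())))
    (sym (∑ᵛ-zero {N} {3} λ τ → Local.∏-factor-¬ok (kinds true τ) (lookup σ) λ ok → ¬h (Equivalence.from (T-∧ {isPerm σ})
      (isPerm⁺ σ (Local.ok⇒injective (kinds true τ) ok) ,
       profile⇒isD σ (λ i → lookup τ i , subst (λ k → Profile (lookup σ) k i) (kinds-odd τ i) (ok⇒profile (lookup σ) (kinds true τ) ok i))))))
  ... | yes h = begin
    (if isPerm σ ∧ isD σ then permWeight σ else 0#)   ≡⟨ cong (λ t → if t then permWeight σ else 0#) (Equivalence.to T-≡ h) ⟩
    permWeight σ                                      ≈⟨ permWeight≈∏-factor σ τ₀ ok₀ ⟩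
    ∏ (λ i → Local.factor (kinds true τ₀) i (lookup σ)) ≈⟨ ∑ᵛ-single {N} {3} τ₀ others ⟨
    ∑ᵛ {N} {3} (λ τ → ∏ (λ i → Local.factor (kinds true τ) i (lookup σ))) ∎
    where
    inj : Inj (lookup σ)
    inj = isPerm⁻ σ (proj₁ (Equivalence.to (T-∧ {isPerm σ}) h))
    profile = isD⇒profile σ (proj₂ (Equivalence.to (T-∧ {isPerm σ}) h)) inj
    τ₀ : Vec (Fin 3) N
    τ₀ = V.tabulate (proj₁ ∘ profile)
    ok₀ : ∀ i → Order.Ok (kinds true τ₀) (lookup σ) i
    ok₀ = profile⇒ok (lookup σ) inj (kinds true τ₀) λ i → subst (λ k → Profile (lookup σ) k i)
      (≡.sym (≡.trans (kinds-odd τ₀ i) (cong (kind (evenB (toℕ i))) (VP.lookup∘tabulate (proj₁ ∘ profile) i)))) (proj₂ (profile i))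
    others : ∀ τ → τ ≢ τ₀ → ∏ (λ i → Local.factor (kinds true τ) i (lookup σ)) ≈ 0#
    others τ τ≢τ₀ = Local.∏-factor-¬ok (kinds true τ) (lookup σ) λ ok → τ≢τ₀ (≡.trans (≡.sym (VP.tabulate∘lookup τ))
      (VP.tabulate-cong λ i → profile-unique (lookup σ) inj (evenB (toℕ i)) (lookup τ i) (proj₁ (profile i)) i
        (subst (λ k → Profile (lookup σ) k i) (kinds-odd τ i) (ok⇒profile (lookup σ) (kinds true τ) ok i)) (proj₂ (profile i))))

  -- The kinds move to the outer sum because the order in which the values are summed out depends on
  -- them.
  Qhat≈walks : ∀ n → Qhat R lam a b c d e f n ≈ walks true 0 (2 ℕ.* n)
  Qhat≈walks n = begin
    sumR R (L.map permWeight (Dperms n))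
      ≈⟨ sumR-filter (λ σ → isPerm σ ∧ isD σ) permWeight (allVecs N N) ⟩
    sumR R (L.map (λ σ → if isPerm σ ∧ isD σ then permWeight σ else 0#) (allVecs N N))
      ≈⟨ sumR-allVecs N N (λ σ → if isPerm σ ∧ isD σ then permWeight σ else 0#) ⟩
    ∑ᵛ {N} {N} (λ σ → if isPerm σ ∧ isD σ then permWeight σ else 0#)
      ≈⟨ ∑ᵛ-cong {N} {N} permWeight-split ⟩
    ∑ᵛ {N} {N} (λ σ → ∑ᵛ {N} {3} (λ τ → ∏ (λ i → Local.factor (kinds true τ) i (lookup σ))))
      ≈⟨ ∑ᵛ-swap {N} {N} {N} {3} (λ σ τ → ∏ (λ i → Local.factor (kinds true τ) i (lookup σ))) ⟩
    ∑ᵛ {N} {3} (λ τ → ∑ᵛ {N} {N} (λ σ → ∏ (λ i → Local.factor (kinds true τ) i (lookup σ))))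
      ≈⟨ ∑ᵛ-cong {N} {3} (λ τ → ∑ᵛ-∏-factor (kinds true τ)) ⟩
    walks true 0 N ∎
    where N = 2 ℕ.* n

-- Depth `m` settles the coefficients below the m-th power of t, so the equality for all `n < m` is
-- the identity of formal power series with the infinite fraction.
theorem4p4 : ∀ {c ℓ : Level} (R : CommutativeRing c ℓ)
    → let open CommutativeRing R in
    (lam : Carrier) (a : ℕ → Carrier) (b c d : ℕ → ℕ → Carrier) (e f : ℕ → Carrier)
    → (n m : ℕ) → n < m
    → Qhat R lam a b c d e f n
    ≈ Jfrac R (αcoef R lam a b c d e f) (δcoef R lam a b c d e f) 1 m n
theorem4p4 R lam a b c d e f n m n<m =
  CommutativeRing.trans R (Assembly.Qhat≈walks R lam a b c d e f n) (Paths.walks≈Jfrac R lam a b c d e f n n<m)
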